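{- Let $\frac25\leq p\leq\frac12$, and let $\mathcal F\subset 2^{[n]}$ be a shifted non-trivial $3$-wise intersecting family. If $\mathcal F\not\subset\mathrm{BD}_3(n)$, then $\mu_p(\mathcal F)<\mu_p(\mathrm{BD}_3(n))-0.0018$.
   Context: Let $[n]=\{1,2,\ldots,n\}$ and let $2^{[n]}$ be its power set. For $0<p<1$, $q=1-p$, the $p$-measure of a family $\mathcal G\subset 2^{[n]}$ is $\mu_p(\mathcal G)=\sum_{G\in\mathcal G}p^{|G|}q^{n-|G|}$. A family $\mathcal G\subset 2^{[n]}$ is $3$-wise intersecting if $G_1\cap G_2\cap G_3\neq\emptyset$ for all $G_1,G_2,G_3\in\mathcal G$ (not necessarily distinct); it is non-trivial if $\bigcap_{G\in\mathcal G}G=\emptyset$. (Non-trivial $3$-wise intersecting families exist only for $n\ge4$.) The family $\mathrm{BD}_3(n)$ is $\{F\in 2^{[n]}:|F\cap[4]|\geq 3\}$; its $p$-measure is $4p^3q+p^4$ for $n\ge 4$. A family $\mathcal F\subset 2^{[n]}$ is shifted if, whenever $F\in\mathcal F$ and $1\leq i<j\leq n$ satisfy $F\cap\{i,j\}=\{j\}$, then $(F\setminus\{j\})\cup\{i\}\in\mathcal F$. -}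

module Defs where

open import Algebra.Bundles.Raw using (RawSemiring)
import Algebra.Definitions.RawSemiring as RawSemiringDefs
open import Data.Fin.Base using (Fin; toℕ)
import Data.Fin.Base as Fin
open import Data.Fin.Subset
  using (Subset; inside; outside; Nonempty; ⁅_⁆; _∩_; _∪_; _─_; ∣_∣)
import Data.Fin.Subset as Subset
open import Data.List.Base using (List; []; _∷_; _++_; map; filter; foldr)
open import Data.Nat.Base as ℕ using (ℕ; zero; suc; _∸_)
import Data.Nat.Properties as ℕ
open import Data.Product.Base using (Σ-syntax; ∃; _×_; _,_)
open import Data.Rational.Base as ℚ using (ℚ; 0ℚ; 1ℚ)
import Data.Rational.Properties as ℚ
open import Data.Rational.Solver using (module +-*-Solver)
open import Data.Vec.Base using ([]; _∷_; tabulate)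
open import Level using (0ℓ)
open import Relation.Binary.PropositionalEquality
  using (_≡_; refl; sym; trans; cong; subst)
open import Relation.Nullary.Decidable using (does)
open import Relation.Unary using (Pred; Decidable; Empty; _∈_)

------------------------------------------------------------------------
-- Real numbers, as Cauchy sequences of rationals.  Two sequences may
-- represent the same real; the order relations below depend only on the
-- real represented.

IsCauchy : (ℕ → ℚ) → Set
IsCauchy a = ∀ ε → 0ℚ ℚ.< ε →
  ∃ λ N → ∀ m n → N ℕ.≤ m → N ℕ.≤ n → ℚ.∣ a m ℚ.- a n ∣ ℚ.≤ ε

record ℝ : Set where
  constructor mkℝ
  field
    seq    : ℕ → ℚ
    cauchy : IsCauchy seq

open ℝ public

infix 4 _<_ _≤_ _≈_

_<_ : ℝ → ℝ → Set
x < y = Σ[ ε ∈ ℚ ] 0ℚ ℚ.< ε ×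
  ∃ λ N → ∀ n → N ℕ.≤ n → seq x n ℚ.+ ε ℚ.≤ seq y n

_≤_ : ℝ → ℝ → Set
x ≤ y = ∀ ε → 0ℚ ℚ.< ε →
  ∃ λ N → ∀ n → N ℕ.≤ n → seq x n ℚ.≤ seq y n ℚ.+ ε

private abstract
  module _ (ε : ℚ) (ε>0 : 0ℚ ℚ.< ε) (K : ℚ) (K>0 : 0ℚ ℚ.< K) where

    instance
      K-pos : ℚ.Positive K
      K-pos = ℚ.positive K>0

      K-nonZero : ℚ.NonZero K
      K-nonZero = ℚ.pos⇒nonZero K

    frac : ℚ
    frac = ε ℚ.* ℚ.1/ K

    frac>0 : 0ℚ ℚ.< frac
    frac>0 = ℚ.positive⁻¹ frac {{ℚ.pos*pos⇒pos ε {{ℚ.positive ε>0}} (ℚ.1/ K) {{ℚ.1/pos⇒pos K}}}}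

    K*frac : K ℚ.* frac ≡ ε
    K*frac = trans (ℚ.*-comm K frac)
            (trans (ℚ.*-assoc ε (ℚ.1/ K) K)
            (trans (cong (ε ℚ.*_) (ℚ.*-inverseˡ K)) (ℚ.*-identityʳ ε)))

  eventuallyBounded : ∀ {a} → IsCauchy a →
    ∃ λ B → ∃ λ N → 0ℚ ℚ.≤ B × (∀ n → N ℕ.≤ n → ℚ.∣ a n ∣ ℚ.≤ B)
  eventuallyBounded {a} c with c 1ℚ (ℚ.positive⁻¹ 1ℚ)
  ... | N , h = 1ℚ ℚ.+ ℚ.∣ a N ∣ , N
    , ℚ.+-mono-≤ {0ℚ} {1ℚ} {0ℚ} (ℚ.nonNegative⁻¹ 1ℚ) (ℚ.0≤∣p∣ (a N))
    , λ n N≤n → begin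
        ℚ.∣ a n ∣                          ≡⟨ cong ℚ.∣_∣ (split (a n) (a N)) ⟩
        ℚ.∣ (a n ℚ.- a N) ℚ.+ a N ∣        ≤⟨ ℚ.∣p+q∣≤∣p∣+∣q∣ (a n ℚ.- a N) (a N) ⟩
        ℚ.∣ a n ℚ.- a N ∣ ℚ.+ ℚ.∣ a N ∣    ≤⟨ ℚ.+-monoˡ-≤ ℚ.∣ a N ∣ (h n N N≤n ℕ.≤-refl) ⟩
        1ℚ ℚ.+ ℚ.∣ a N ∣                   ∎
    where
    open ℚ.≤-Reasoning
    open +-*-Solver
    split : ∀ p q → p ≡ (p ℚ.- q) ℚ.+ q
    split = solve 2 (λ p q → p := (p :- q) :+ q) refl

  +-cauchy : ∀ {a b} → IsCauchy a → IsCauchy b → IsCauchy (λ n → a n ℚ.+ b n)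
  +-cauchy {a} {b} ca cb ε ε>0
    with ca (frac ε ε>0 (1ℚ ℚ.+ 1ℚ) (ℚ.positive⁻¹ (1ℚ ℚ.+ 1ℚ))) (frac>0 ε ε>0 (1ℚ ℚ.+ 1ℚ) (ℚ.positive⁻¹ (1ℚ ℚ.+ 1ℚ)))
       | cb (frac ε ε>0 (1ℚ ℚ.+ 1ℚ) (ℚ.positive⁻¹ (1ℚ ℚ.+ 1ℚ))) (frac>0 ε ε>0 (1ℚ ℚ.+ 1ℚ) (ℚ.positive⁻¹ (1ℚ ℚ.+ 1ℚ)))
  ... | M , ha | N , hb = M ℕ.⊔ N , λ m n m≥ n≥ → begin
    ℚ.∣ (a m ℚ.+ b m) ℚ.- (a n ℚ.+ b n) ∣
      ≡⟨ cong ℚ.∣_∣ (regroup (a m) (b m) (a n) (b n)) ⟩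
    ℚ.∣ (a m ℚ.- a n) ℚ.+ (b m ℚ.- b n) ∣
      ≤⟨ ℚ.∣p+q∣≤∣p∣+∣q∣ (a m ℚ.- a n) (b m ℚ.- b n) ⟩
    ℚ.∣ a m ℚ.- a n ∣ ℚ.+ ℚ.∣ b m ℚ.- b n ∣
      ≤⟨ ℚ.+-mono-≤ (ha m n (ℕ.m⊔n≤o⇒m≤o M N m≥) (ℕ.m⊔n≤o⇒m≤o M N n≥))
                    (hb m n (ℕ.m⊔n≤o⇒n≤o M N m≥) (ℕ.m⊔n≤o⇒n≤o M N n≥)) ⟩
    δ ℚ.+ δ
      ≡⟨ double δ ⟩
    (1ℚ ℚ.+ 1ℚ) ℚ.* δ
      ≡⟨ K*frac ε ε>0 (1ℚ ℚ.+ 1ℚ) (ℚ.positive⁻¹ (1ℚ ℚ.+ 1ℚ)) ⟩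
    ε ∎
    where
    open ℚ.≤-Reasoning
    open +-*-Solver
    δ : ℚ
    δ = frac ε ε>0 (1ℚ ℚ.+ 1ℚ) (ℚ.positive⁻¹ (1ℚ ℚ.+ 1ℚ))
    regroup : ∀ p q r s → (p ℚ.+ q) ℚ.- (r ℚ.+ s) ≡ (p ℚ.- r) ℚ.+ (q ℚ.- s)
    regroup = solve 4 (λ p q r s → (p :+ q) :- (r :+ s) := (p :- r) :+ (q :- s)) refl
    double : ∀ p → p ℚ.+ p ≡ (1ℚ ℚ.+ 1ℚ) ℚ.* p
    double = solve 1 (λ p → p :+ p := (con 1ℚ :+ con 1ℚ) :* p) refl

  neg-cauchy : ∀ {a} → IsCauchy a → IsCauchy (λ n → ℚ.- a n)
  neg-cauchy {a} ca ε ε>0 with ca ε ε>0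
  ... | N , h = N , λ m n m≥ n≥ →
    subst (ℚ._≤ ε) (trans (sym (ℚ.∣-p∣≡∣p∣ (a m ℚ.- a n)))
                          (cong ℚ.∣_∣ (distrib (a m) (a n))))
          (h m n m≥ n≥)
    where
    open +-*-Solver
    distrib : ∀ p q → ℚ.- (p ℚ.- q) ≡ (ℚ.- p) ℚ.- (ℚ.- q)
    distrib = solve 2 (λ p q → :- (p :- q) := (:- p) :- (:- q)) refl

  *-cauchyBounded : ∀ {a b} → IsCauchy a → IsCauchy b →
    (∃ λ B → ∃ λ N → 0ℚ ℚ.≤ B × (∀ n → N ℕ.≤ n → ℚ.∣ a n ∣ ℚ.≤ B)) →
    (∃ λ C → ∃ λ N → 0ℚ ℚ.≤ C × (∀ n → N ℕ.≤ n → ℚ.∣ b n ∣ ℚ.≤ C)) →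
    IsCauchy (λ n → a n ℚ.* b n)
  *-cauchyBounded {a} {b} ca cb (B , M₁ , B≥0 , boundA) (C , N₁ , C≥0 , boundB) ε ε>0 = result
    where
    open ℚ.≤-Reasoning
    open +-*-Solver

    K : ℚ
    K = 1ℚ ℚ.+ (B ℚ.+ C)

    K>0 : 0ℚ ℚ.< K
    K>0 = ℚ.+-mono-<-≤ {0ℚ} {1ℚ} {0ℚ} (ℚ.positive⁻¹ 1ℚ) (ℚ.+-mono-≤ {0ℚ} {B} {0ℚ} B≥0 C≥0)

    δ : ℚ
    δ = frac ε ε>0 K K>0

    δ>0 : 0ℚ ℚ.< δ
    δ>0 = frac>0 ε ε>0 K K>0

    regroup : ∀ p q r s →
      (p ℚ.* q) ℚ.- (r ℚ.* s) ≡ p ℚ.* (q ℚ.- s) ℚ.+ s ℚ.* (p ℚ.- r)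
    regroup = solve 4 (λ p q r s →
      (p :* q) :- (r :* s) := p :* (q :- s) :+ s :* (p :- r)) refl

    absorb : ∀ p q r → p ℚ.* r ℚ.+ q ℚ.* r ≡ 0ℚ ℚ.+ (p ℚ.+ q) ℚ.* r
    absorb = solve 3 (λ p q r → p :* r :+ q :* r := con 0ℚ :+ (p :+ q) :* r) refl

    collect : ∀ p r → r ℚ.+ p ℚ.* r ≡ (1ℚ ℚ.+ p) ℚ.* r
    collect = solve 2 (λ p r → r :+ p :* r := (con 1ℚ :+ p) :* r) refl

    ∣*∣≤ : ∀ p q {P Q} → 0ℚ ℚ.≤ P → ℚ.∣ p ∣ ℚ.≤ P → ℚ.∣ q ∣ ℚ.≤ Q →
           ℚ.∣ p ℚ.* q ∣ ℚ.≤ P ℚ.* Q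
    ∣*∣≤ p q {P} {Q} P≥0 p≤ q≤ = begin
      ℚ.∣ p ℚ.* q ∣          ≡⟨ ℚ.∣p*q∣≡∣p∣*∣q∣ p q ⟩
      ℚ.∣ p ∣ ℚ.* ℚ.∣ q ∣    ≤⟨ ℚ.*-monoʳ-≤-nonNeg ℚ.∣ q ∣ {{ℚ.∣-∣-nonNeg q}} p≤ ⟩
      P ℚ.* ℚ.∣ q ∣          ≤⟨ ℚ.*-monoˡ-≤-nonNeg P {{ℚ.nonNegative P≥0}} q≤ ⟩
      P ℚ.* Q                ∎

    result : ∃ λ N → ∀ m n → N ℕ.≤ m → N ℕ.≤ n →
             ℚ.∣ a m ℚ.* b m ℚ.- a n ℚ.* b n ∣ ℚ.≤ ε
    result with ca δ δ>0 | cb δ δ>0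
    ... | M₂ , ha | N₂ , hb = (M₁ ℕ.⊔ N₁) ℕ.⊔ (M₂ ℕ.⊔ N₂) , λ m n m≥ n≥ →
      let m≥₁ = ℕ.m⊔n≤o⇒m≤o (M₁ ℕ.⊔ N₁) _ m≥
          n≥₁ = ℕ.m⊔n≤o⇒m≤o (M₁ ℕ.⊔ N₁) _ n≥
          m≥₂ = ℕ.m⊔n≤o⇒n≤o (M₁ ℕ.⊔ N₁) _ m≥
          n≥₂ = ℕ.m⊔n≤o⇒n≤o (M₁ ℕ.⊔ N₁) _ n≥
      in begin
        ℚ.∣ a m ℚ.* b m ℚ.- a n ℚ.* b n ∣
          ≡⟨ cong ℚ.∣_∣ (regroup (a m) (b m) (a n) (b n)) ⟩
        ℚ.∣ a m ℚ.* (b m ℚ.- b n) ℚ.+ b n ℚ.* (a m ℚ.- a n) ∣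
          ≤⟨ ℚ.∣p+q∣≤∣p∣+∣q∣ (a m ℚ.* (b m ℚ.- b n)) (b n ℚ.* (a m ℚ.- a n)) ⟩
        ℚ.∣ a m ℚ.* (b m ℚ.- b n) ∣ ℚ.+ ℚ.∣ b n ℚ.* (a m ℚ.- a n) ∣
          ≤⟨ ℚ.+-mono-≤
               (∣*∣≤ (a m) (b m ℚ.- b n) B≥0
                 (boundA m (ℕ.m⊔n≤o⇒m≤o M₁ N₁ m≥₁))
                 (hb m n (ℕ.m⊔n≤o⇒n≤o M₂ N₂ m≥₂) (ℕ.m⊔n≤o⇒n≤o M₂ N₂ n≥₂)))
               (∣*∣≤ (b n) (a m ℚ.- a n) C≥0
                 (boundB n (ℕ.m⊔n≤o⇒n≤o M₁ N₁ n≥₁))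
                 (ha m n (ℕ.m⊔n≤o⇒m≤o M₂ N₂ m≥₂) (ℕ.m⊔n≤o⇒m≤o M₂ N₂ n≥₂))) ⟩
        B ℚ.* δ ℚ.+ C ℚ.* δ
          ≡⟨ absorb B C δ ⟩
        0ℚ ℚ.+ (B ℚ.+ C) ℚ.* δ
          ≤⟨ ℚ.+-monoˡ-≤ ((B ℚ.+ C) ℚ.* δ) (ℚ.<⇒≤ δ>0) ⟩
        δ ℚ.+ (B ℚ.+ C) ℚ.* δ
          ≡⟨ collect (B ℚ.+ C) δ ⟩
        K ℚ.* δ
          ≡⟨ K*frac ε ε>0 K K>0 ⟩
        ε ∎

  *-cauchy : ∀ {a b} → IsCauchy a → IsCauchy b → IsCauchy (λ n → a n ℚ.* b n)
  *-cauchy {a} {b} ca cb =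
    *-cauchyBounded {a} {b} ca cb (eventuallyBounded {a} ca) (eventuallyBounded {b} cb)

fromℚ : ℚ → ℝ
fromℚ r = mkℝ (λ _ → r) λ ε ε>0 → 0 , λ _ _ _ _ →
  subst (λ d → ℚ.∣ d ∣ ℚ.≤ ε) (sym (ℚ.+-inverseʳ r)) (ℚ.<⇒≤ ε>0)

infixl 6 _+_ _-_
infixl 7 _*_
infix  8 -_

_+_ : ℝ → ℝ → ℝ
x + y = mkℝ (λ n → seq x n ℚ.+ seq y n) (+-cauchy {seq x} {seq y} (cauchy x) (cauchy y))

-_ : ℝ → ℝ
- x = mkℝ (λ n → ℚ.- seq x n) (neg-cauchy {seq x} (cauchy x))

_-_ : ℝ → ℝ → ℝ
x - y = x + (- y)

_*_ : ℝ → ℝ → ℝ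
x * y = mkℝ (λ n → seq x n ℚ.* seq y n) (*-cauchy {seq x} {seq y} (cauchy x) (cauchy y))

0ℝ 1ℝ : ℝ
0ℝ = fromℚ 0ℚ
1ℝ = fromℚ 1ℚ

_≈_ : ℝ → ℝ → Set
x ≈ y = x ≤ y × y ≤ x

ℝ-rawSemiring : RawSemiring 0ℓ 0ℓ
ℝ-rawSemiring = record
  { Carrier = ℝ ; _≈_ = _≈_ ; _+_ = _+_ ; _*_ = _*_ ; 0# = 0ℝ ; 1# = 1ℝ }

open RawSemiringDefs ℝ-rawSemiring public using (_^_)

------------------------------------------------------------------------
-- Families of subsets of [n].  The element i of [n] is the element of
-- Fin n with toℕ equal to i - 1.

Family : ℕ → Set₁
Family n = Pred (Subset n) 0ℓ

allSubsets : ∀ n → List (Subset n)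
allSubsets zero    = [] ∷ []
allSubsets (suc n) =
  map (inside ∷_) (allSubsets n) ++ map (outside ∷_) (allSubsets n)

sum : List ℝ → ℝ
sum = foldr _+_ 0ℝ

-- Membership in a family is always decidable classically; the decision
-- procedure only serves to select the terms of the sum.
μ : ∀ {n} → ℝ → {𝒢 : Family n} → Decidable 𝒢 → ℝ
μ {n} p 𝒢? =
  sum (map (λ G → p ^ ∣ G ∣ * (1ℝ - p) ^ (n ∸ ∣ G ∣)) (filter 𝒢? (allSubsets n)))

ThreeWiseIntersecting : ∀ {n} → Family n → Set
ThreeWiseIntersecting 𝒢 = ∀ {G₁ G₂ G₃} →
  G₁ ∈ 𝒢 → G₂ ∈ 𝒢 → G₃ ∈ 𝒢 → Nonempty (G₁ ∩ G₂ ∩ G₃)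

⋂ : ∀ {n} → Family n → Pred (Fin n) 0ℓ
⋂ 𝒢 i = ∀ G → G ∈ 𝒢 → i Subset.∈ G

NonTrivial : ∀ {n} → Family n → Set
NonTrivial 𝒢 = Empty (⋂ 𝒢)

Shifted : ∀ {n} → Family n → Set
Shifted 𝓕 = ∀ {F i j} → F ∈ 𝓕 → i Fin.< j →
  F ∩ (⁅ i ⁆ ∪ ⁅ j ⁆) ≡ ⁅ j ⁆ → ((F ─ ⁅ j ⁆) ∪ ⁅ i ⁆) ∈ 𝓕

-- The subset [k] ∩ [n] of [n].
initial : ∀ {n} → ℕ → Subset n
initial k = tabulate λ i → does (toℕ i ℕ.<? k)

BD₃ : ∀ n → Family n
BD₃ n F = ∣ F ∩ initial 4 ∣ ℕ.≥ 3

BD₃? : ∀ n → Decidable (BD₃ n)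
BD₃? n F = 3 ℕ.≤? ∣ F ∩ initial 4 ∣

{-# OPTIONS --safe #-}
module Submission where

-- Reading a set as a walk (an element is a step up, a non-element a step right), a shifted 3-wise
-- intersecting family has no three members A, B, C with |A ∩ [i]| + |B ∩ [i]| + |C ∩ [i]| ≤ 2i for all i:
-- otherwise shifts would make them disjoint. This property passes to the closure f of the family under
-- domination of walks, and only f is considered from then on. Write p, q = 1 - p and f(w) for the measure
-- of the link of f at a prefix w. A cross-intersecting pair B ⊆ A satisfies p μ(A) + q μ(B) ≤ p, as p ≤ 1/2.
--
-- Some F ∈ f omits 1. If no such F omits a second element of [4], then f(1) ≤ p and f(0111) ≤ p, so
-- μ(f) ≤ p² + q p⁴. Otherwise that F is the third member in
--   p f(111) + q f(100) ≤ p,  p f(110) + q f(101) ≤ p,  p f(110) + q f(0111) ≤ p,  p f(110) + q f(100) ≤ p,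
-- in f(0111) ≤ p and in f(100) ≤ p (p/q)³, and a positive combination of these bounds everything except the
-- sets starting with 0 but not with 0111. Those reach the line y = 2x + 3 (after the first step); if k + 1 is
-- the largest number of steps right that a member needs to reach it, then the members that reach it earlier
-- are intersecting from there on, which saves a factor p, and the walks are counted by Fuss-Catalan numbers.

open import Data.Bool.Base using (Bool; true; false; T; not; _∧_; _∨_; if_then_else_)
open import Data.Bool.Properties using (T?)
open import Data.Empty using (⊥-elim)
open import Data.Fin.Base using (Fin; zero; suc; toℕ; fromℕ<)
open import Data.Fin.Properties using (all?; toℕ-fromℕ<)
open import Data.Fin.Subset as Subset using (Subset; inside; outside; ⁅_⁆; _∩_; _∪_; _─_; ∣_∣)
import Data.Fin.Subset.Properties as Subset
open import Data.Product.Base using (∃; _×_; _,_; proj₁; proj₂)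
open import Data.Sum.Base using (_⊎_; inj₁; inj₂; [_,_]′)
open import Data.Unit.Base using (tt)
open import Data.Vec.Base using ([]; _∷_; here; there; _[_]≔_; tabulate)
open import Relation.Binary.PropositionalEquality
open import Relation.Nullary using (¬_; yes; no; Dec; ¬?)
open import Relation.Nullary.Decidable
  using (True; isYes; toWitness; fromWitness; map′; _×-dec_; decidable-stable)

-- The weighted cross inequalities record this trade-off. They are combined as in linear programming
-- duality, with multipliers that are nonnegative for 2/5 ≤ p ≤ 1/2.
--
-- The obstacle is the sets starting with 0 but not with 0111. The plain probability of reaching y =
-- 2x + 3 is too large for them (near p = 1/2 by a factor close to 2), hence the saving through the
-- latest member. How late it comes is unknown, so the estimate must be uniform in k. A step right
-- together with the two steps up that compensate it has weight p²q, which is at most 1/8 on the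
-- whole range; with 1/8 in its place, p enters only polynomially and finitely many rational
-- evaluations suffice.
--
-- A real p is handled through its rational approximants: measures of upward closed families vary by
-- at most n times the error in p, and a small surplus in the rational bound pays for that.

module Walks where

  import Algebra.Properties.CommutativeSemigroup as CommutativeSemigroup
  import Data.Bool.Properties as Bool
  open import Data.Nat.Base
  open import Data.Nat.Induction using (<-wellFounded)
  open import Data.Nat.Properties
  open import Data.Vec.Base using (_++_)
  open import Data.Nat.Solver using (module +-*-Solver)
  open import Defs using (Family; Shifted; ThreeWiseIntersecting)
  open import Induction.WellFounded using (Acc; acc)
  open import Relation.Unary using (Decidable)

  -- Prefix counts and the shifting argument

  count : ∀ {n} → Subset n → ℕ → ℕ
  count _             zero    = 0
  count []            (suc i) = 0
  count (inside  ∷ A) (suc i) = suc (count A i)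
  count (outside ∷ A) (suc i) = count A i

  bit : Bool → ℕ
  bit inside  = 1
  bit outside = 0

  -- The sum of the three counts, taken column by column, because `improve` peels off one column at
  -- a time.
  columns : ∀ {n} → Subset n → Subset n → Subset n → ℕ → ℕ
  columns _       _       _       zero    = 0
  columns []      []      []      (suc i) = 0
  columns (a ∷ A) (b ∷ B) (c ∷ C) (suc i) = bit a + (bit b + (bit c + columns A B C i))

  count-∷ : ∀ {n} x (A : Subset n) i → count (x ∷ A) (suc i) ≡ bit x + count A i
  count-∷ inside  A i = refl
  count-∷ outside A i = refl

  columns≡counts : ∀ {n} (A B C : Subset n) i → columns A B C i ≡ count A i + count B i + count C i
  columns≡counts A B C zero = refl
  columns≡counts [] [] [] (suc i) = refl
  columns≡counts (a ∷ A) (b ∷ B) (c ∷ C) (suc i)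
    rewrite columns≡counts A B C i | count-∷ a A i | count-∷ b B i | count-∷ c C i =
    regroup (bit a) (bit b) (bit c) (count A i) (count B i) (count C i)
    where
    open +-*-Solver
    regroup : ∀ a b c x y z → a + (b + (c + (x + y + z))) ≡ a + x + (b + y) + (c + z)
    regroup = solve 6 (λ a b c x y z → a :+ (b :+ (c :+ (x :+ y :+ z))) := a :+ x :+ (b :+ y) :+ (c :+ z)) refl

  infix 4 _⇝_

  -- A single shift. The target position is the head once the common prefix is skipped, which suits
  -- recursion on the length.
  data _⇝_ : ∀ {n} → Subset n → Subset n → Set where
    swap : ∀ {n} {A : Subset n} {j} → j Subset.∈ A → outside ∷ A ⇝ inside ∷ (A [ j ]≔ outside)
    skip : ∀ {n} {A B : Subset n} {x} → A ⇝ B → x ∷ A ⇝ x ∷ B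

  ─⁅⁆ : ∀ {n} (A : Subset n) j → A ─ ⁅ j ⁆ ≡ A [ j ]≔ outside
  ─⁅⁆ (x ∷ A) zero    = cong (outside ∷_) (Subset.p─⊥≡p A)
  ─⁅⁆ (x ∷ A) (suc j) = cong (x ∷_) (─⁅⁆ A j)

  ∩⁅⁆ : ∀ {n} {A : Subset n} {j} → j Subset.∈ A → A ∩ ⁅ j ⁆ ≡ ⁅ j ⁆
  ∩⁅⁆ {A = _ ∷ A} here      = cong (inside ∷_) (Subset.∩-zeroʳ A)
  ∩⁅⁆ {A = x ∷ _} (there m) = cong₂ _∷_ (Bool.∧-zeroʳ x) (∩⁅⁆ m)

  Shifted-∷ : ∀ {n} {𝓕 : Family (suc n)} x → Shifted 𝓕 → Shifted (λ G → 𝓕 (x ∷ G))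
  Shifted-∷ {𝓕 = 𝓕} x sh {F} {i} {j} F∈ i<j eq =
    subst (λ y → 𝓕 (y ∷ ((F ─ ⁅ j ⁆) ∪ ⁅ i ⁆)))
      (Bool.∨-identityʳ x)
      (sh {i = suc i} {j = suc j} F∈ (s≤s i<j) (cong₂ _∷_ (Bool.∧-zeroʳ x) eq))

  ⇝-closed : ∀ {n} {𝓕 : Family n} {A B} → Shifted 𝓕 → 𝓕 A → A ⇝ B → 𝓕 B
  ⇝-closed {𝓕 = 𝓕} sh A∈ (swap {A = A} {j} m) =
    subst (λ B → 𝓕 (inside ∷ B)) (trans (Subset.∪-identityʳ _) (─⁅⁆ A j))
      (sh {i = zero} {j = suc j} A∈ (s≤s z≤n)
        (cong (outside ∷_) (trans (cong (A ∩_) (Subset.∪-identityˡ _)) (∩⁅⁆ m))))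
  ⇝-closed {𝓕 = 𝓕} sh A∈ (skip {x = x} s) =
    ⇝-closed {𝓕 = λ G → 𝓕 (x ∷ G)} (Shifted-∷ {𝓕 = 𝓕} x sh) A∈ s

  -- The sum of the (0-based) elements.
  weight : ∀ {n} → Subset n → ℕ
  weight []      = 0
  weight (x ∷ A) = ∣ A ∣ + weight A

  ∣remove∣ : ∀ {n} {A : Subset n} {j} → j Subset.∈ A → ∣ A ∣ ≡ suc ∣ A [ j ]≔ outside ∣
  ∣remove∣ here = refl
  ∣remove∣ {A = inside  ∷ A} (there m) = cong suc (∣remove∣ m)
  ∣remove∣ {A = outside ∷ A} (there m) = ∣remove∣ m

  weight-remove : ∀ {n} {A : Subset n} {j} → j Subset.∈ A → weight (A [ j ]≔ outside) ≤ weight A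
  weight-remove here = ≤-refl
  weight-remove {A = x ∷ A} {suc j} (there m) =
    +-mono-≤ (≤-trans (n≤1+n _) (≤-reflexive (sym (∣remove∣ m)))) (weight-remove m)

  ∣⇝∣ : ∀ {n} {A B : Subset n} → A ⇝ B → ∣ A ∣ ≡ ∣ B ∣
  ∣⇝∣ (swap m) = ∣remove∣ m
  ∣⇝∣ (skip {x = inside}  s) = cong suc (∣⇝∣ s)
  ∣⇝∣ (skip {x = outside} s) = ∣⇝∣ s

  weight-⇝ : ∀ {n} {A B : Subset n} → A ⇝ B → weight B < weight A
  weight-⇝ (swap m) = +-mono-<-≤ (≤-reflexive (sym (∣remove∣ m))) (weight-remove m)
  weight-⇝ (skip s) = +-mono-≤-< (≤-reflexive (sym (∣⇝∣ s))) (weight-⇝ s)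

  columns-swap : ∀ {n} (A B C : Subset n) i → columns A B C i ≡ columns B A C i
  columns-swap A B C i = begin
    columns A B C i                   ≡⟨ columns≡counts A B C i ⟩
    count A i + count B i + count C i ≡⟨ cong (_+ count C i) (+-comm (count A i) (count B i)) ⟩
    count B i + count A i + count C i ≡⟨ columns≡counts B A C i ⟨
    columns B A C i                   ∎
    where open ≡-Reasoning

  -- A prefix of length i contains the 0-based position j exactly when i > j, and only there does
  -- the removal gain one.
  columns-remove : ∀ {n} {A : Subset n} {j} (B C : Subset n) → j Subset.∈ A → ∀ i →
    suc (columns (A [ j ]≔ outside) B C i) ≡ columns A B C i ⊎
    i ≤ toℕ j × columns (A [ j ]≔ outside) B C i ≡ columns A B C i
  columns-remove B       C       m         zero    = inj₂ (z≤n , refl)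
  columns-remove (b ∷ B) (c ∷ C) here      (suc i) = inj₁ refl
  columns-remove {A = a ∷ A} {suc j} (b ∷ B) (c ∷ C) (there m) (suc i) with columns-remove B C m i
  ... | inj₂ (i≤j , eq) = inj₂ (s≤s i≤j , cong (λ s → bit a + (bit b + (bit c + s))) eq)
  ... | inj₁ eq         = inj₁ (trans (out (bit a) (bit b) (bit c) _) (cong (λ s → bit a + (bit b + (bit c + s))) eq))
    where
    out : ∀ a b c s → suc (a + (b + (c + s))) ≡ a + (b + (c + suc s))
    out a b c s = begin
      suc (a + (b + (c + s))) ≡⟨ +-suc a _ ⟨
      a + suc (b + (c + s))   ≡⟨ cong (a +_) (+-suc b _) ⟨
      a + (b + suc (c + s))   ≡⟨ cong (λ s → a + (b + s)) (+-suc c s) ⟨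
      a + (b + (c + suc s))   ∎
      where open ≡-Reasoning

  remove-bound : ∀ {n} {A : Subset n} {j} (B C : Subset n) {b : ℕ → ℕ} → j Subset.∈ A →
    (∀ i → columns A B C i ≤ b i) → (∀ i → i ≤ toℕ j → suc (columns A B C i) ≤ b i) →
    ∀ i → suc (columns (A [ j ]≔ outside) B C i) ≤ b i
  remove-bound B C m h h′ i with columns-remove B C m i
  ... | inj₁ eq         = ≤-trans (≤-reflexive eq) (h i)
  ... | inj₂ (i≤j , eq) = ≤-trans (≤-reflexive (cong suc eq)) (h′ i i≤j)

  -- The allowance t makes the bound inductive: a first column with s entries turns t into 2 + t - s
  -- for the rest.
  Below : ∀ {n} → Subset n → Subset n → Subset n → ℕ → Set
  Below A B C t = ∀ i → columns A B C i ≤ i * 2 + t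

  Improvable : ∀ {n} → Subset n → Subset n → Subset n → ℕ → Set
  Improvable A B C t =
    (∃ λ A′ → A ⇝ A′ × Below A′ B C t) ⊎ (∃ λ B′ → B ⇝ B′ × Below A B′ C t)

  -- The last column before the common element j with at most one entry absorbs one of the
  -- three copies of j; if there is no such column, the bound has slack up to j.
  improve : ∀ {n} (A B C : Subset n) {j} t → j Subset.∈ A → j Subset.∈ B → j Subset.∈ C →
    Below A B C t → Improvable A B C t ⊎ (∀ i → i ≤ toℕ j → suc (columns A B C i) ≤ i * 2 + t)
  improve _ _ _ zero here here here h with h 1
  ... | s≤s (s≤s ())
  improve _ _ _ (suc t) here here here h = inj₂ λ { zero _ → s≤s z≤n }
  improve (a ∷ A) (b ∷ B) (c ∷ C) {suc j} t (there mA) (there mB) (there mC) h =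
    cases a b c h (improve A B C _ mA mB mC (below a b c h))
    where
    shape : ∀ s u i → s + u ≡ 2 + t → s + (i * 2 + u) ≡ suc i * 2 + t
    shape s u i eq = begin
      s + (i * 2 + u)  ≡⟨ x∙yz≈y∙xz s (i * 2) u ⟩
      i * 2 + (s + u)  ≡⟨ cong (i * 2 +_) eq ⟩
      i * 2 + (2 + t)  ≡⟨ x∙yz≈y∙xz (i * 2) 2 t ⟩
      2 + (i * 2 + t)  ∎
      where
      open ≡-Reasoning
      open CommutativeSemigroup +-commutativeSemigroup using (x∙yz≈y∙xz)

    size : Bool → Bool → Bool → ℕ
    size a b c = bit a + (bit b + bit c)

    columns-∷ : ∀ a b c (A B C : Subset _) i → columns (a ∷ A) (b ∷ B) (c ∷ C) (suc i) ≡ size a b c + columns A B C i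
    columns-∷ a b c A B C i = trans (cong (bit a +_) (sym (+-assoc (bit b) (bit c) _))) (sym (+-assoc (bit a) _ _))

    total : ∀ a b c → Below (a ∷ A) (b ∷ B) (c ∷ C) t → size a b c + (2 + t ∸ size a b c) ≡ 2 + t
    total a b c h = m+[n∸m]≡n {size a b c} (≤-trans (m≤m+n (size a b c) _) (≤-trans (≤-reflexive (sym (columns-∷ a b c A B C 0))) (h 1)))

    below : ∀ a b c → Below (a ∷ A) (b ∷ B) (c ∷ C) t → Below A B C (2 + t ∸ size a b c)
    below a b c h i = +-cancelˡ-≤ (size a b c) _ _ (begin
      size a b c + columns A B C i                    ≡⟨ columns-∷ a b c A B C i ⟨
      columns (a ∷ A) (b ∷ B) (c ∷ C) (suc i)         ≤⟨ h (suc i) ⟩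
      suc i * 2 + t                                   ≡⟨ shape (size a b c) _ i (total a b c h) ⟨
      size a b c + (i * 2 + (2 + t ∸ size a b c))     ∎)
      where open ≤-Reasoning

    below⁻¹ : ∀ a b c {A B C : Subset _} u → size a b c + u ≡ 2 + t →
      Below A B C u → Below (a ∷ A) (b ∷ B) (c ∷ C) t
    below⁻¹ a b c u eq h zero    = z≤n
    below⁻¹ a b c {A} {B} {C} u eq h (suc i) = begin
      columns (a ∷ A) (b ∷ B) (c ∷ C) (suc i)  ≡⟨ columns-∷ a b c A B C i ⟩
      size a b c + columns A B C i             ≤⟨ +-monoʳ-≤ (size a b c) (h i) ⟩
      size a b c + (i * 2 + u)                 ≡⟨ shape _ u i eq ⟩
      suc i * 2 + t                            ∎
      where open ≤-Reasoning

    Slack : ℕ → Set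
    Slack u = ∀ i → i ≤ toℕ j → suc (columns A B C i) ≤ i * 2 + u

    Goal : Bool → Bool → Bool → Set
    Goal a b c = Improvable (a ∷ A) (b ∷ B) (c ∷ C) t ⊎
      (∀ i → i ≤ suc (toℕ j) → suc (columns (a ∷ A) (b ∷ B) (c ∷ C) i) ≤ i * 2 + t)

    skipped : ∀ a b c → Below (a ∷ A) (b ∷ B) (c ∷ C) t →
      Improvable A B C (2 + t ∸ size a b c) → Goal a b c
    skipped a b c h (inj₁ (A′ , s , h′)) = inj₁ (inj₁ (_ , skip s , below⁻¹ a b c _ (total a b c h) h′))
    skipped a b c h (inj₂ (B′ , s , h′)) = inj₁ (inj₂ (_ , skip s , below⁻¹ a b c _ (total a b c h) h′))

    swapA : ∀ b c {u} → suc (size outside b c) + u ≡ 2 + t →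
      Below A B C (suc u) → Slack (suc u) → Goal outside b c
    swapA b c {u} eq h′ slack = inj₁ (inj₁ (_ , swap mA , below⁻¹ inside b c u eq λ i →
      s≤s⁻¹ (≤-trans (remove-bound B C mA h′ slack i) (≤-reflexive (+-suc (i * 2) u)))))

    swapB : ∀ a c {u} → size a inside c + u ≡ 2 + t →
      Below A B C (suc u) → Slack (suc u) → Goal a outside c
    swapB a c {u} eq h′ slack = inj₁ (inj₂ (_ , swap mB , below⁻¹ a inside c u eq λ i →
      ≤-trans (≤-reflexive (columns-swap A _ C i)) (s≤s⁻¹ (≤-trans
        (remove-bound A C mB
          (λ i → ≤-trans (≤-reflexive (columns-swap B A C i)) (h′ i))
          (λ i i≤j → ≤-trans (s≤s (≤-reflexive (columns-swap B A C i))) (slack i i≤j)) i)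
        (≤-reflexive (+-suc (i * 2) u))))))

    full : ∀ a b c → Below (a ∷ A) (b ∷ B) (c ∷ C) t → 2 ≤ size a b c →
      Slack (2 + t ∸ size a b c) → Goal a b c
    full a b c h 2≤s slack = inj₂ λ
      { zero _ → ≤-trans (slack 0 z≤n) (∸-monoʳ-≤ (2 + t) 2≤s)
      ; (suc i) (s≤s i≤j) → ≤-trans
          (≤-reflexive (trans (cong suc (columns-∷ a b c A B C i)) (sym (+-suc (size a b c) _))))
          (≤-trans (+-monoʳ-≤ (size a b c) (slack i i≤j)) (≤-reflexive (shape (size a b c) _ i (total a b c h)))) }

    cases : ∀ a b c (h : Below (a ∷ A) (b ∷ B) (c ∷ C) t) →
      Improvable A B C (2 + t ∸ size a b c) ⊎ Slack (2 + t ∸ size a b c) → Goal a b c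
    cases a b c h (inj₁ imp) = skipped a b c h imp
    -- Moving j into a column with at most one entry costs one there; the removal regains it beyond
    -- j, and the slack covers the prefixes up to j. Such a column is free in A or in B, so the
    -- third set never moves.
    cases outside outside outside h (inj₂ slack) = swapA outside outside refl (below outside outside outside h) slack
    cases outside inside  outside h (inj₂ slack) = swapA inside outside refl (below outside inside outside h) slack
    cases outside outside inside  h (inj₂ slack) = swapA outside inside refl (below outside outside inside h) slack
    cases inside  outside outside h (inj₂ slack) = swapB inside outside refl (below inside outside outside h) slack
    cases inside  inside  outside h (inj₂ slack) = full inside inside outside h ≤-refl slack
    cases inside  outside inside  h (inj₂ slack) = full inside outside inside h ≤-refl slack
    cases outside inside  inside  h (inj₂ slack) = full outside inside inside h ≤-refl slack
    cases inside  inside  inside  h (inj₂ slack) = full inside inside inside h (n≤1+n 2) slack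

  -- Infinite descent: the common element of the three members lets `improve` shift A or B, which
  -- keeps the bound and lowers the weight. Its alternative, slack with t = 0, fails at the empty
  -- prefix.
  shifted-triple : ∀ {n} {𝓕 : Family n} → Shifted 𝓕 → ThreeWiseIntersecting 𝓕 →
    ∀ {A B C} → 𝓕 A → 𝓕 B → 𝓕 C → ¬ (∀ i → count A i + count B i + count C i ≤ i * 2)
  shifted-triple {𝓕 = 𝓕} sh int {A} {B} {C} A∈ B∈ C∈ h =
    go A B A∈ B∈ (<-wellFounded _) λ i →
      ≤-trans (≤-reflexive (columns≡counts A B C i)) (≤-trans (h i) (m≤m+n _ 0))
    where
    go : ∀ A B → 𝓕 A → 𝓕 B → Acc _<_ (weight A + weight B) → ¬ Below A B C 0
    go A B A∈ B∈ (acc rs) h with int A∈ B∈ C∈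
    ... | j , m with Subset.x∈p∩q⁻ A (B ∩ C) m
    ... | mA , m′ with Subset.x∈p∩q⁻ B C m′
    ... | mB , mC with improve A B C 0 mA mB mC h
    ... | inj₁ (inj₁ (A′ , s , h′)) =
          go A′ B (⇝-closed {𝓕 = 𝓕} sh A∈ s) B∈ (rs (+-monoˡ-< (weight B) (weight-⇝ s))) h′
    ... | inj₁ (inj₂ (B′ , s , h′)) =
          go A B′ A∈ (⇝-closed {𝓕 = 𝓕} sh B∈ s) (rs (+-monoʳ-< (weight A) (weight-⇝ s))) h′
    ... | inj₂ slack with slack 0 z≤n
    ... | ()

  -- Domination of walks and the closure

  infix 4 _≼_ _≼?_

  -- B arises from A by adding elements and moving elements to the left, so this order covers both
  -- inclusion and shifting.
  _≼_ : ∀ {n} → Subset n → Subset n → Set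
  A ≼ B = ∀ i → count A i ≤ count B i

  count-⊓ : ∀ {n} (A : Subset n) i → count A (i ⊓ n) ≡ count A i
  count-⊓ A             zero    = refl
  count-⊓ []            (suc i) = refl
  count-⊓ (inside  ∷ A) (suc i) = cong suc (count-⊓ A i)
  count-⊓ (outside ∷ A) (suc i) = count-⊓ A i

  _≼?_ : ∀ {n} (A B : Subset n) → Dec (A ≼ B)
  _≼?_ {n} A B = map′ to (λ h i → h (toℕ i)) (all? λ (i : Fin (suc n)) → count A (toℕ i) ≤? count B (toℕ i))
    where
    to : (∀ (i : Fin (suc n)) → count A (toℕ i) ≤ count B (toℕ i)) → A ≼ B
    to h i = subst₂ _≤_ (count-⊓ A i) (count-⊓ B i)
      (subst (λ i → count A i ≤ count B i) (toℕ-fromℕ< i⊓n<1+n) (h (fromℕ< i⊓n<1+n)))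
      where
      i⊓n<1+n : i ⊓ n < suc n
      i⊓n<1+n = s≤s (m⊓n≤n i n)

  ≼-refl : ∀ {n} {A : Subset n} → A ≼ A
  ≼-refl i = ≤-refl

  ∷-≼ : ∀ {n} {A B : Subset n} x → A ≼ B → x ∷ A ≼ x ∷ B
  ∷-≼ x       h zero    = z≤n
  ∷-≼ inside  h (suc i) = s≤s (h i)
  ∷-≼ outside h (suc i) = h i

  outside≼inside : ∀ {n} (A : Subset n) → outside ∷ A ≼ inside ∷ A
  outside≼inside A zero    = z≤n
  outside≼inside A (suc i) = n≤1+n _

  infix 4 _∈_

  _∈_ : ∀ {n} → Subset n → (Subset n → Bool) → Set
  A ∈ f = T (f A)

  Upward : ∀ {n} → (Subset n → Bool) → Set
  Upward f = ∀ {A B} → A ≼ B → A ∈ f → B ∈ f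

  Triples : ∀ {n} → (Subset n → Bool) → Set
  Triples f = ∀ {A B C} → A ∈ f → B ∈ f → C ∈ f → ¬ (∀ i → count A i + count B i + count C i ≤ i * 2)

  module _ {n} (𝓕 : Family n) (𝓕? : Decidable 𝓕) where

    closure? : Decidable (λ G → ∃ λ F → 𝓕 F × F ≼ G)
    closure? G = Subset.anySubset? λ F → 𝓕? F ×-dec F ≼? G

    closure : Subset n → Bool
    closure G = isYes (closure? G)

    ⊆-closure : ∀ {F} → 𝓕 F → F ∈ closure
    ⊆-closure {F} F∈ = fromWitness {a? = closure? F} (F , F∈ , ≼-refl)

    closure-upward : Upward closure
    closure-upward {A} {B} A≼B A∈ with toWitness {a? = closure? A} A∈
    ... | F , F∈ , F≼A = fromWitness {a? = closure? B} (F , F∈ , λ i → ≤-trans (F≼A i) (A≼B i))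

    closure-triples : Shifted 𝓕 → ThreeWiseIntersecting 𝓕 → Triples closure
    closure-triples sh int {A} {B} {C} A∈ B∈ C∈ h
      with toWitness {a? = closure? A} A∈ | toWitness {a? = closure? B} B∈ | toWitness {a? = closure? C} C∈
    ... | F , F∈ , F≼A | G , G∈ , G≼B | H , H∈ , H≼C =
      shifted-triple {𝓕 = 𝓕} sh int F∈ G∈ H∈ λ i →
        ≤-trans (+-mono-≤ (+-mono-≤ (F≼A i) (G≼B i)) (H≼C i)) (h i)

  -- Disjoint pairs, links and cross-intersection

  data Disjoint : ∀ {n} → Subset n → Subset n → Set where
    []  : Disjoint [] []
    _∷_ : ∀ {n} {A B : Subset n} {x y} → T (not (x ∧ y)) → Disjoint A B → Disjoint (x ∷ A) (y ∷ B)

  Disjoint-sym : ∀ {n} {A B : Subset n} → Disjoint A B → Disjoint B A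
  Disjoint-sym [] = []
  Disjoint-sym (_∷_ {x = inside}  {outside} t d) = t ∷ Disjoint-sym d
  Disjoint-sym (_∷_ {x = outside} {inside}  t d) = t ∷ Disjoint-sym d
  Disjoint-sym (_∷_ {x = outside} {outside} t d) = t ∷ Disjoint-sym d

  count-disjoint : ∀ {n} {A B : Subset n} → Disjoint A B → ∀ i → count A i + count B i ≤ i
  count-disjoint d zero = z≤n
  count-disjoint [] (suc i) = z≤n
  count-disjoint (_∷_ {x = inside}  {outside} t d) (suc i) = s≤s (count-disjoint d i)
  count-disjoint (_∷_ {A = A} {B} {outside} {inside}  t d) (suc i) =
    ≤-trans (≤-reflexive (+-suc (count A i) (count B i))) (s≤s (count-disjoint d i))
  count-disjoint (_∷_ {x = outside} {outside} t d) (suc i) = m≤n⇒m≤1+n (count-disjoint d i)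

  count≤ : ∀ {n} (A : Subset n) i → count A i ≤ i
  count≤ A             zero    = z≤n
  count≤ []            (suc i) = z≤n
  count≤ (inside  ∷ A) (suc i) = s≤s (count≤ A i)
  count≤ (outside ∷ A) (suc i) = m≤n⇒m≤1+n (count≤ A i)

  infixl 7 _/ᶠ_

  _/ᶠ_ : ∀ {n} → (Subset (suc n) → Bool) → Bool → Subset n → Bool
  (f /ᶠ x) A = f (x ∷ A)

  _∪ᶠ_ _∩ᶠ_ : ∀ {n} → (Subset n → Bool) → (Subset n → Bool) → Subset n → Bool
  (f ∪ᶠ g) A = f A ∨ g A
  (f ∩ᶠ g) A = f A ∧ g A

  infix 4 _⊆ᶠ_
  _⊆ᶠ_ : ∀ {n} → (Subset n → Bool) → (Subset n → Bool) → Set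
  f ⊆ᶠ g = ∀ {A} → A ∈ f → A ∈ g

  CrossIntersecting : ∀ {n} → (Subset n → Bool) → (Subset n → Bool) → Set
  CrossIntersecting f g = ∀ {A B} → A ∈ f → B ∈ g → ¬ Disjoint A B

  ∈∪⁻ : ∀ x {y} → T (x ∨ y) → T x ⊎ T y
  ∈∪⁻ true  t = inj₁ t
  ∈∪⁻ false t = inj₂ t

  ∈∪ˡ : ∀ x {y} → T x → T (x ∨ y)
  ∈∪ˡ true  t = t

  ∈∪ʳ : ∀ x {y} → T y → T (x ∨ y)
  ∈∪ʳ true  t = tt
  ∈∪ʳ false t = t

  ∈∩⁻ : ∀ x {y} → T (x ∧ y) → T x × T y
  ∈∩⁻ true t = tt , t

  ∈∩⁺ : ∀ x {y} → T x → T y → T (x ∧ y)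
  ∈∩⁺ true t t′ = t′

  Upward-/ : ∀ {n} {f : Subset (suc n) → Bool} x → Upward f → Upward (f /ᶠ x)
  Upward-/ x up A≼B = up (∷-≼ x A≼B)

  Upward-∪ : ∀ {n} {f g : Subset n → Bool} → Upward f → Upward g → Upward (f ∪ᶠ g)
  Upward-∪ {f = f} upf upg {A} {B} A≼B A∈ with ∈∪⁻ (f A) A∈
  ... | inj₁ A∈f = ∈∪ˡ (f B) (upf A≼B A∈f)
  ... | inj₂ A∈g = ∈∪ʳ (f B) (upg A≼B A∈g)

  Upward-∩ : ∀ {n} {f g : Subset n → Bool} → Upward f → Upward g → Upward (f ∩ᶠ g)
  Upward-∩ {f = f} upf upg {A} {B} A≼B A∈ with ∈∩⁻ (f A) A∈
  ... | A∈f , A∈g = ∈∩⁺ (f B) (upf A≼B A∈f) (upg A≼B A∈g)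

  -- Walks reaching the line y = 2x + t

  -- The walk of A (an inside is a step up, an outside a step right) does not reach
  -- the line y = 2x + t within k steps right.
  data Misses : ∀ {n} → ℕ → ℕ → Subset n → Set where
    end     : ∀ {t k} → Misses (suc t) k []
    rise    : ∀ {n t k} {A : Subset n} → Misses t k A → Misses (suc t) k (inside ∷ A)
    run     : ∀ {n t k} {A : Subset n} → Misses (3 + t) k A → Misses (suc t) (suc k) (outside ∷ A)
    exhaust : ∀ {n t} {A : Subset n} → Misses (suc t) 0 (outside ∷ A)

  -- The walks of A and B coincide until they reach y = 2x + t, in fewer than k steps right,
  -- and have no common step up afterwards.
  data Parts : ∀ {n} → ℕ → ℕ → Subset n → Subset n → Set where
    fork : ∀ {n k} {A B : Subset n} → Disjoint A B → Parts 0 (suc k) A B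
    rise : ∀ {n t k} {A B : Subset n} → Parts t k A B → Parts (suc t) k (inside ∷ A) (inside ∷ B)
    run  : ∀ {n t k} {A B : Subset n} → Parts (3 + t) k A B → Parts (suc t) (suc k) (outside ∷ A) (outside ∷ B)

  Misses? : ∀ {n} t k (A : Subset n) → Dec (Misses t k A)
  Misses? zero    k       A             = no λ ()
  Misses? (suc t) k       []            = yes end
  Misses? (suc t) k       (inside  ∷ A) = map′ rise (λ { (rise m) → m }) (Misses? t k A)
  Misses? (suc t) zero    (outside ∷ A) = yes exhaust
  Misses? (suc t) (suc k) (outside ∷ A) = map′ run (λ { (run m) → m }) (Misses? (3 + t) k A)

  -- No prefix of the walk of A with fewer than k steps right reaches y = 2x + 3.
  Late : ∀ {n} → ℕ → Subset n → Set
  Late k A = ∀ i → count A i * 3 ≤ i * 2 + 2 ⊎ count A i + k ≤ i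

  misses-count : ∀ {n t k} {A : Subset n} → Misses t k A →
    ∀ i → suc (count A i * 3) ≤ i * 2 + t ⊎ count A i + suc k ≤ i
  misses-count end      zero    = inj₁ (s≤s z≤n)
  misses-count (rise _) zero    = inj₁ (s≤s z≤n)
  misses-count (run _)  zero    = inj₁ (s≤s z≤n)
  misses-count exhaust  zero    = inj₁ (s≤s z≤n)
  misses-count {t = suc t} end (suc i) = inj₁ (s≤s z≤n)
  misses-count {t = suc t} (rise m) (suc i) with misses-count m i
  ... | inj₁ h = inj₁ (≤-trans (+-monoʳ-≤ 3 h) (≤-reflexive (cong (2 +_) (sym (+-suc (i * 2) t)))))
  ... | inj₂ h = inj₂ (s≤s h)
  misses-count {t = suc t} {suc k} {outside ∷ A} (run m) (suc i) with misses-count m i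
  ... | inj₁ h = inj₁ (≤-trans h (≤-reflexive (trans (+-suc (i * 2) (2 + t)) (cong suc (+-suc (i * 2) (1 + t))))))
  ... | inj₂ h = inj₂ (≤-trans (≤-reflexive (+-suc (count A i) (suc k))) (s≤s h))
  misses-count {A = outside ∷ A} exhaust (suc i) =
    inj₂ (≤-trans (≤-reflexive (+-comm (count A i) 1)) (s≤s (count≤ A i)))

  misses-late : ∀ {n k} {A : Subset n} → Misses 3 k A → Late (suc k) A
  misses-late m i with misses-count m i
  ... | inj₁ h = inj₁ (s≤s⁻¹ (≤-trans h (≤-reflexive (+-suc (i * 2) 2))))
  ... | inj₂ h = inj₂ h

  -- Up to the fork both walks are on or below the line, where a count is at most (2i + t) / 3.
  -- Afterwards the two counts together grow by at most 1 per step, less than the slope 4/3.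
  parts-slope : ∀ {n t k} {A B : Subset n} → Parts t k A B →
    ∀ i → (count A i + count B i) * 3 ≤ i * 4 + t * 2
  parts-slope m zero = z≤n
  parts-slope {A = A} {B} (fork d) i@(suc _) = begin
    (count A i + count B i) * 3  ≤⟨ *-monoˡ-≤ 3 (count-disjoint d i) ⟩
    i * 3                        ≤⟨ *-monoʳ-≤ i (n≤1+n 3) ⟩
    i * 4                        ≡⟨ +-identityʳ (i * 4) ⟨
    i * 4 + 0                    ∎
    where open ≤-Reasoning
  parts-slope {t = suc t} {A = _ ∷ A} {_ ∷ B} (rise m) (suc i) = begin
    (suc (count A i) + suc (count B i)) * 3  ≡⟨ cong (_* 3) (cong suc (+-suc (count A i) (count B i))) ⟩
    6 + (count A i + count B i) * 3          ≤⟨ +-monoʳ-≤ 6 (parts-slope m i) ⟩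
    6 + (i * 4 + t * 2)                      ≡⟨ solve 2 (λ i t → con 6 :+ (i :* con 4 :+ t :* con 2) := con 4 :+ i :* con 4 :+ (con 2 :+ t :* con 2)) refl i t ⟩
    suc i * 4 + suc t * 2                    ∎
    where
    open ≤-Reasoning
    open +-*-Solver
  parts-slope {t = suc t} {A = _ ∷ A} {_ ∷ B} (run m) (suc i) =
    ≤-trans (parts-slope m i) (≤-reflexive (solve 2 (λ i t → i :* con 4 :+ (con 6 :+ t :* con 2) := con 4 :+ i :* con 4 :+ (con 2 :+ t :* con 2)) refl i t))
    where open +-*-Solver

  -- A fork after x < k steps right happens at i = 3x + t with both counts equal to 2x + t, so their
  -- sum is i + x + t; beyond it the sum grows no faster than i.
  parts-sum : ∀ {n t k} {A B : Subset n} → Parts t k A B →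
    ∀ i → suc (count A i + count B i) ≤ i + (k + t)
  parts-sum (fork {k = k} d) i = ≤-trans (s≤s (count-disjoint d i))
    (≤-trans (≤-reflexive (+-comm 1 i)) (+-monoʳ-≤ i (s≤s z≤n)))
  parts-sum {k = k} (rise {t = t} m) zero = ≤-trans (s≤s z≤n) (≤-reflexive (sym (+-suc k t)))
  parts-sum (run _) zero = s≤s z≤n
  parts-sum {k = k} (rise {t = t} {A = A} {B} m) (suc i) = begin
    suc (suc (count A i) + suc (count B i))  ≡⟨ cong (λ s → suc (suc s)) (+-suc (count A i) (count B i)) ⟩
    2 + suc (count A i + count B i)          ≤⟨ +-monoʳ-≤ 2 (parts-sum m i) ⟩
    2 + (i + (k + t))                        ≡⟨ solve 3 (λ i k t → con 2 :+ (i :+ (k :+ t)) := con 1 :+ i :+ (k :+ (con 1 :+ t))) refl i k t ⟩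
    suc i + (k + suc t)                      ∎
    where
    open ≤-Reasoning
    open +-*-Solver
  parts-sum (run {t = t} {k} m) (suc i) = ≤-trans (parts-sum m i)
    (≤-reflexive (solve 3 (λ i k t → i :+ (k :+ (con 3 :+ t)) := con 1 :+ i :+ (con 1 :+ k :+ (con 1 :+ t))) refl i k t))
    where open +-*-Solver

  -- While C is below the line, the slopes 4/3 and 2/3 add up to 2. Once C has made k steps right,
  -- this deficit offsets the excess in `parts-sum`. The remaining 2 is paid later by a common first
  -- step right of the three members.
  parts-late : ∀ {n k} {A B C : Subset n} → Parts 3 k A B → Late k C →
    ∀ i → count A i + count B i + count C i ≤ i * 2 + 2
  parts-late {k = k} {A} {B} {C} m late i with late i
  -- Three times the sum is at most 6i + 8, so the sum is at most 2i + 2 after rounding down.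
  ... | inj₁ h = s≤s⁻¹ (*-cancelʳ-< 3 (count A i + count B i + count C i) (suc (i * 2 + 2)) (s≤s (begin
    (count A i + count B i + count C i) * 3            ≡⟨ *-distribʳ-+ 3 (count A i + count B i) (count C i) ⟩
    (count A i + count B i) * 3 + count C i * 3        ≤⟨ +-mono-≤ (parts-slope m i) h ⟩
    i * 4 + 6 + (i * 2 + 2)                            ≡⟨ solve 1 (λ i → i :* con 4 :+ con 6 :+ (i :* con 2 :+ con 2) := con 2 :+ (i :* con 2 :+ con 2) :* con 3) refl i ⟩
    2 + (i * 2 + 2) * 3                                ∎)))
    where
    open ≤-Reasoning
    open +-*-Solver
  ... | inj₂ h = +-cancelˡ-≤ (1 + k) _ _ (begin
    1 + k + (count A i + count B i + count C i)        ≡⟨ solve 3 (λ k s c → con 1 :+ k :+ (s :+ c) := con 1 :+ s :+ (c :+ k)) refl k (count A i + count B i) (count C i) ⟩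
    suc (count A i + count B i) + (count C i + k)      ≤⟨ +-mono-≤ (parts-sum m i) h ⟩
    i + (k + 3) + i                                    ≡⟨ solve 2 (λ i k → i :+ (k :+ con 3) :+ i := con 1 :+ k :+ (i :* con 2 :+ con 2)) refl i k ⟩
    1 + k + (i * 2 + 2)                                ∎)
    where
    open ≤-Reasoning
    open +-*-Solver

  -- Counting first passages

  -- passages k t counts the walks which reach y = 2x + t first after exactly k steps right, and
  -- earlier k t is the sum of passages j t * 8 ^ (k ∸ j) over j < k.
  passages : ℕ → ℕ → ℕ
  passages zero    t       = 1
  passages (suc k) zero    = 0
  passages (suc k) (suc t) = passages (suc k) t + passages k (3 + t)

  earlier : ℕ → ℕ → ℕ
  earlier zero    t       = 0
  earlier (suc k) zero    = 8 ^ suc k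
  earlier (suc k) (suc t) = earlier (suc k) t + earlier k (3 + t)

  -- With s = t + 1 this is the Raney number s / (3k + s) times the binomial coefficient (3k + s
  -- over k), cleared of denominators. `l` and `m` are variables so that the recursive calls can
  -- match differently arranged sums.
  passages-closed : ∀ k t {l m} → l ≡ k * 2 + suc t → m ≡ k * 3 + t →
    passages k (suc t) * (k ! * l !) ≡ suc t * m !
  passages-closed zero t refl refl = trans (+-identityʳ _) (+-identityʳ _)
  passages-closed (suc k) zero {l} {m} refl refl = begin
    passages k 3 * (suc k ! * (2 + (k * 2 + 1)) !)
      ≡⟨ cong (λ l → passages k 3 * (suc k ! * l !)) (solve 1 (λ k → con 2 :+ (k :* con 2 :+ con 1) := k :* con 2 :+ con 3) refl k) ⟩
    passages k 3 * (suc k * k ! * (k * 2 + 3) !)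
      ≡⟨ solve 4 (λ n k a b → n :* (k :* a :* b) := k :* (n :* (a :* b))) refl (passages k 3) (suc k) (k !) ((k * 2 + 3) !) ⟩
    suc k * (passages k 3 * (k ! * (k * 2 + 3) !))
      ≡⟨ cong (suc k *_) (passages-closed k 2 refl refl) ⟩
    suc k * (3 * (k * 3 + 2) !)
      ≡⟨ solve 2 (λ k a → (con 1 :+ k) :* (con 3 :* a) := (con 1 :+ (k :* con 3 :+ con 2)) :* a) refl k ((k * 3 + 2) !) ⟩
    suc (k * 3 + 2) * (k * 3 + 2) !
      ≡⟨ cong _! (solve 1 (λ k → con 1 :+ (k :* con 3 :+ con 2) := con 3 :+ (k :* con 3 :+ con 0)) refl k) ⟩
    (3 + (k * 3 + 0)) !
      ≡⟨ +-identityʳ _ ⟨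
    1 * (3 + (k * 3 + 0)) ! ∎
    where
    open ≡-Reasoning
    open +-*-Solver
  passages-closed (suc k) (suc t) refl refl = begin
    (x + y) * (suc k ! * (2 + (k * 2 + suc (suc t))) !)
      ≡⟨ cong (λ l → (x + y) * (suc k ! * l !)) eq₁ ⟩
    (x + y) * (suc k * k ! * (suc r * r !))
      ≡⟨ solve 6 (λ x y k a r b → (x :+ y) :* ((con 1 :+ k) :* a :* ((con 1 :+ r) :* b)) :=
           (con 1 :+ r) :* (x :* ((con 1 :+ k) :* a :* b)) :+ (con 1 :+ k) :* (y :* (a :* ((con 1 :+ r) :* b))))
           refl x y k (k !) r (r !) ⟩
    suc r * (x * (suc k ! * r !)) + suc k * (y * (k ! * (suc r) !))
      ≡⟨ cong₂ (λ a b → suc r * a + suc k * b)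
           (passages-closed (suc k) t eq₂ eq₃)
           (passages-closed k (3 + t) eq₄ eq₅) ⟩
    suc r * (suc t * s !) + suc k * ((4 + t) * s !)
      ≡⟨ solve 3 (λ k t a →
           (con 4 :+ (k :* con 2 :+ t)) :* ((con 1 :+ t) :* a) :+ (con 1 :+ k) :* ((con 4 :+ t) :* a) :=
           (con 2 :+ t) :* ((con 4 :+ (k :* con 3 :+ t)) :* a)) refl k t (s !) ⟩
    suc (suc t) * (suc s * s !)
      ≡⟨ cong (λ l → suc (suc t) * l !) (solve 2 (λ k t → con 4 :+ (k :* con 3 :+ t) := con 3 :+ (k :* con 3 :+ (con 1 :+ t))) refl k t) ⟩
    suc (suc t) * (3 + (k * 3 + suc t)) ! ∎
    where
    open ≡-Reasoning
    open +-*-Solver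
    x = passages (suc k) (suc t)
    y = passages k (4 + t)
    r = 3 + (k * 2 + t)
    s = 3 + (k * 3 + t)
    eq₁ : 2 + (k * 2 + suc (suc t)) ≡ suc r
    eq₁ = solve 2 (λ k t → con 2 :+ (k :* con 2 :+ (con 2 :+ t)) := con 4 :+ (k :* con 2 :+ t)) refl k t
    eq₂ : r ≡ suc k * 2 + suc t
    eq₂ = solve 2 (λ k t → con 3 :+ (k :* con 2 :+ t) := con 2 :+ k :* con 2 :+ (con 1 :+ t)) refl k t
    eq₃ : s ≡ suc k * 3 + t
    eq₃ = refl
    eq₄ : suc r ≡ k * 2 + suc (3 + t)
    eq₄ = solve 2 (λ k t → con 4 :+ (k :* con 2 :+ t) := k :* con 2 :+ (con 4 :+ t)) refl k t
    eq₅ : s ≡ k * 3 + (3 + t)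
    eq₅ = solve 2 (λ k t → con 3 :+ (k :* con 3 :+ t) := k :* con 3 :+ (con 3 :+ t)) refl k t

  -- The ratio of consecutive values tends to 27/4, which is below 8; the closed form makes the
  -- comparison polynomial in k.
  passages-growth : ∀ k → passages (suc k) 3 ≤ 8 * passages k 3
  passages-growth k = *-cancelʳ-≤ _ _ e {{e≢0}} (begin
    x * e
      ≡⟨ cong (λ l → x * (suc k * k ! * l !)) (solve 1 (λ k → con 5 :+ k :* con 2 := con 2 :+ (k :* con 2 :+ con 3)) refl k) ⟩
    x * (suc k ! * (2 + (k * 2 + 3)) !)
      ≡⟨ passages-closed (suc k) 2 refl refl ⟩
    3 * (3 + (k * 3 + 2)) !
      ≡⟨ solve 2 (λ k a →
           con 3 :* ((con 3 :+ (k :* con 3 :+ con 2)) :* ((con 2 :+ (k :* con 3 :+ con 2)) :* ((con 1 :+ (k :* con 3 :+ con 2)) :* a))) :=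
           con 3 :* (con 5 :+ k :* con 3) :* (con 4 :+ k :* con 3) :* (con 1 :+ k) :* (con 3 :* a)) refl k ((k * 3 + 2) !) ⟩
    3 * (5 + k * 3) * (4 + k * 3) * suc k * (3 * (k * 3 + 2) !)
      ≡⟨ cong (3 * (5 + k * 3) * (4 + k * 3) * suc k *_)
           (passages-closed k 2 {l = 3 + k * 2} (+-comm 3 (k * 2)) refl) ⟨
    3 * (5 + k * 3) * (4 + k * 3) * suc k * (y * (k ! * b))
      ≤⟨ m≤m+n _ _ ⟩
    -- The added coefficient is 8 (5 + 2k) (4 + 2k) - 3 (5 + 3k) (4 + 3k).
    3 * (5 + k * 3) * (4 + k * 3) * suc k * (y * (k ! * b)) + (100 + k * 63 + k * k * 5) * suc k * (y * (k ! * b))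
      ≡⟨ solve 4 (λ k y a b →
           con 3 :* (con 5 :+ k :* con 3) :* (con 4 :+ k :* con 3) :* (con 1 :+ k) :* (y :* (a :* b))
             :+ (con 100 :+ k :* con 63 :+ k :* k :* con 5) :* (con 1 :+ k) :* (y :* (a :* b)) :=
           con 8 :* y :* ((con 1 :+ k) :* a :* ((con 5 :+ k :* con 2) :* ((con 4 :+ k :* con 2) :* b)))) refl k y (k !) b ⟩
    8 * y * e ∎)
    where
    open ≤-Reasoning
    open +-*-Solver
    x = passages (suc k) 3
    y = passages k 3
    b = (3 + k * 2) !
    e = suc k * k ! * (5 + k * 2) !
    e≢0 : NonZero e
    e≢0 = m*n≢0 (suc k !) ((5 + k * 2) !) {{suc k !≢0}} {{(5 + k * 2) !≢0}}

  -- Cross-intersecting links at two prefixes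

  count-++ˡ : ∀ {m n} (u : Subset m) (A : Subset n) i → i ≤ m → count (u ++ A) i ≡ count u i
  count-++ˡ u             A zero    _         = refl
  count-++ˡ (inside  ∷ u) A (suc i) (s≤s i≤m) = cong suc (count-++ˡ u A i i≤m)
  count-++ˡ (outside ∷ u) A (suc i) (s≤s i≤m) = count-++ˡ u A i i≤m

  count-++ʳ : ∀ {m n} (u : Subset m) (A : Subset n) j → count (u ++ A) (m + j) ≡ count u m + count A j
  count-++ʳ []            A j = refl
  count-++ʳ (inside  ∷ u) A j = cong suc (count-++ʳ u A j)
  count-++ʳ (outside ∷ u) A j = count-++ʳ u A j

  count-+ : ∀ {n} (A : Subset n) i j → count A (i + j) ≤ count A i + j
  count-+ A             zero    j = count≤ A j
  count-+ []            (suc i) j = z≤n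
  count-+ (inside  ∷ A) (suc i) j = s≤s (count-+ A i j)
  count-+ (outside ∷ A) (suc i) j = count-+ A i j

  prefixed : ∀ {m n} → Subset m → (Subset (m + n) → Bool) → Subset n → Bool
  prefixed u f A = f (u ++ A)

  ++-≼ : ∀ {m n} {u v : Subset m} {A : Subset n} → u ≼ v → u ++ A ≼ v ++ A
  ++-≼ {m} {n} {u} {v} {A} u≼v i with i ≤? m
  ... | yes i≤m = subst₂ _≤_ (sym (count-++ˡ u A i i≤m)) (sym (count-++ˡ v A i i≤m)) (u≼v i)
  ... | no  i≰m = subst (λ i → count (u ++ A) i ≤ count (v ++ A) i) (m+[n∸m]≡n (<⇒≤ (≰⇒> i≰m)))
    (subst₂ _≤_ (sym (count-++ʳ u A (i ∸ m))) (sym (count-++ʳ v A (i ∸ m))) (+-monoˡ-≤ _ (u≼v m)))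

  Upward-prefixed : ∀ {m n} {f : Subset (m + n) → Bool} u → Upward f → Upward (prefixed {m} u f)
  Upward-prefixed []      up A≼B = up A≼B
  Upward-prefixed {f = f} (x ∷ u) up A≼B = Upward-prefixed {f = f /ᶠ x} u (Upward-/ {f = f} x up) A≼B

  -- The sum of the prefix counts is at most 2i up to the end of the prefixes, and grows by at most 2 from there on.
  prefixed-cross : ∀ {m n} {f : Subset (m + n) → Bool} → Triples f → ∀ {F} → F ∈ f → ∀ (u v : Subset m) →
    (∀ i → i ≤ m → count u i + count v i + count F i ≤ i * 2) →
    CrossIntersecting (prefixed {m} u f) (prefixed {m} v f)
  prefixed-cross {m} {n} {f} triples {F} F∈ u v h {A} {B} A∈ B∈ d = triples A∈ B∈ F∈ sum
    where
    sum : ∀ i → count (u ++ A) i + count (v ++ B) i + count F i ≤ i * 2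
    sum i with i ≤? m
    ... | yes i≤m rewrite count-++ˡ u A i i≤m | count-++ˡ v B i i≤m = h i i≤m
    ... | no  i≰m = subst (λ i → count (u ++ A) i + count (v ++ B) i + count F i ≤ i * 2) (m+[n∸m]≡n (<⇒≤ (≰⇒> i≰m))) (far (i ∸ m))
      where
      far : ∀ j → count (u ++ A) (m + j) + count (v ++ B) (m + j) + count F (m + j) ≤ (m + j) * 2
      far j rewrite count-++ʳ u A j | count-++ʳ v B j = begin
        count u m + count A j + (count v m + count B j) + count F (m + j)
          ≤⟨ +-monoʳ-≤ (count u m + count A j + (count v m + count B j)) (count-+ F m j) ⟩
        count u m + count A j + (count v m + count B j) + (count F m + j)
          ≡⟨ solve 6 (λ u a v b c j → u :+ a :+ (v :+ b) :+ (c :+ j) := u :+ v :+ c :+ (a :+ b :+ j)) refl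
               (count u m) (count A j) (count v m) (count B j) (count F m) j ⟩
        count u m + count v m + count F m + (count A j + count B j + j)
          ≤⟨ +-mono-≤ (h m ≤-refl) (+-monoˡ-≤ j (count-disjoint d j)) ⟩
        m * 2 + (j + j)
          ≡⟨ solve 2 (λ m j → m :* con 2 :+ (j :+ j) := (m :+ j) :* con 2) refl m j ⟩
        (m + j) * 2 ∎
        where
        open ≤-Reasoning
        open +-*-Solver

  BoundedBy : ∀ {n} → Subset n → (ℕ → ℕ) → ℕ → Set
  BoundedBy F cap m = ∀ i → i ≤ m → count F i ≤ cap i

  fits? : ∀ {m} (cap : ℕ → ℕ) (u v : Subset m) → Dec (∀ (i : Fin (suc m)) → count u (toℕ i) + count v (toℕ i) + cap (toℕ i) ≤ toℕ i * 2)
  fits? cap u v = all? λ i → count u (toℕ i) + count v (toℕ i) + cap (toℕ i) ≤? toℕ i * 2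

  -- Numerical caps stand in for the unknown third member, so every instance with concrete prefixes
  -- is decided by evaluation.
  fits-cross : ∀ {m n} {f : Subset (m + n) → Bool} → Triples f → ∀ {F} → F ∈ f → ∀ {cap} → BoundedBy F cap m →
    ∀ (u v : Subset m) → True (fits? cap u v) → CrossIntersecting (prefixed {m} u f) (prefixed {m} v f)
  fits-cross {m} {f = f} triples {F} F∈ {cap} F≤cap u v fits =
    prefixed-cross {f = f} triples F∈ u v λ i i≤m →
      ≤-trans (+-monoʳ-≤ (count u i + count v i) (F≤cap i i≤m))
        (subst (λ i → count u i + count v i + cap i ≤ i * 2) (toℕ-fromℕ< (s≤s i≤m)) (toWitness fits (fromℕ< (s≤s i≤m))))

  -- The member that reaches the line last

  module LateMember {n} {f : Subset (suc n) → Bool} (triples : Triples f) where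

    -- A walk of length n < k never makes k steps right, so it would stay below the line throughout,
    -- and three copies of this one member would violate `Triples`.
    late-bounded : ∀ {k A} → A ∈ f /ᶠ outside → Late k A → k ≤ n
    late-bounded {k} {A} A∈ late with k ≤? n
    ... | yes k≤n = k≤n
    ... | no  k≰n = ⊥-elim (triples A∈ A∈ A∈ λ { zero → z≤n ; (suc i) → triple i })
      where
      within : ∀ i → i ≤ n → count A i * 3 ≤ i * 2 + 2
      within i i≤n with late i
      ... | inj₁ h = h
      ... | inj₂ h = ⊥-elim (k≰n (≤-trans (≤-trans (m≤n+m k (count A i)) h) i≤n))
      triple : ∀ i → count A i + count A i + count A i ≤ suc i * 2
      triple i = begin
        count A i + count A i + count A i  ≡⟨ solve 1 (λ a → a :+ a :+ a := a :* con 3) refl (count A i) ⟩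
        count A i * 3                      ≡⟨ cong (_* 3) (count-⊓ A i) ⟨
        count A (i ⊓ n) * 3                ≤⟨ within (i ⊓ n) (m⊓n≤n i n) ⟩
        i ⊓ n * 2 + 2                      ≤⟨ +-monoˡ-≤ 2 (*-monoˡ-≤ 2 (m⊓n≤m i n)) ⟩
        i * 2 + 2                          ≡⟨ +-comm (i * 2) 2 ⟩
        suc i * 2                          ∎
        where
        open ≤-Reasoning
        open +-*-Solver

    Latest : ℕ → Set
    Latest k = (∃ λ A → A ∈ f /ᶠ outside × Late k A) × (∀ {A} → A ∈ f /ᶠ outside → ¬ Misses 3 k A)

    -- A member that misses the line within the current number of steps right is a later one;
    -- `late-bounded` ends the climb.
    latest : ∀ {A} → A ∈ f /ᶠ outside → Late 1 A → ∃ λ k → Latest (suc k)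
    latest = search (suc n) 0 refl
      where
      search : ∀ fuel k → k + fuel ≡ suc n → ∀ {A} → A ∈ f /ᶠ outside → Late (suc k) A → ∃ λ k → Latest (suc k)
      search zero k eq A∈ late = ⊥-elim (<⇒≱ (late-bounded A∈ late)
        (≤-trans (n≤1+n n) (≤-reflexive (trans (sym eq) (+-identityʳ k)))))
      search (suc fuel) k eq {A} A∈ late
        with Subset.anySubset? (λ A → T? (f (outside ∷ A)) ×-dec Misses? 3 (suc k) A)
      ... | yes (B , B∈ , m) = search fuel (suc k) (trans (sym (+-suc k fuel)) eq) B∈ (misses-late m)
      ... | no  none         = k , (A , A∈ , late) , λ B∈ m → none (_ , B∈ , m)

    latest-parts : ∀ {k} → Latest k → ∀ {A B} → A ∈ f /ᶠ outside → B ∈ f /ᶠ outside → ¬ Parts 3 k A B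
    latest-parts ((L , L∈ , late) , _) {A} {B} A∈ B∈ m = triples A∈ B∈ L∈ λ
      { zero    → z≤n
      ; (suc i) → ≤-trans (parts-late m late i) (≤-reflexive (+-comm (i * 2) 2)) }

module Measures where

  open Walks
  import Data.Integer.Base as ℤ
  open import Data.Integer.Base using (+_)
  import Data.Integer.Properties as ℤ
  open import Data.List.Base using (List; []; _∷_; _++_; map; filter)
  open import Data.Nat.Base as ℕ using (ℕ; zero; suc; z≤n; s≤s; _∸_)
  import Data.Nat.Properties as ℕ
  import Data.Nat.Solver
  open import Data.Rational.Base hiding (∣_∣)
  open import Data.Rational.Properties
  open import Data.Rational.Solver using (module +-*-Solver)
  import Data.Rational.Unnormalised.Base as ℚᵘ
  import Data.Rational.Unnormalised.Properties as ℚᵘ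
  import Defs as ℝ
  open import Defs using (ℝ; seq; fromℚ; Family; Shifted; NonTrivial; ThreeWiseIntersecting; allSubsets; μ; BD₃; BD₃?; initial)
  open import Relation.Unary using (Decidable; _⊈_)
  open import Algebra.Definitions.RawSemiring +-*-rawSemiring using (_^_)
  open +-*-Solver using (solve; _:=_; con; _:+_; _:*_; _:-_)

  private module ℕ-Solver = Data.Nat.Solver.+-*-Solver

  -- Inequalities between rationals, and the measure

  ≤-gap : ∀ {a b c} → 0ℚ ≤ c → b - a ≡ c → a ≤ b
  ≤-gap {a} {b} {c} 0≤c eq = begin
    a            ≡⟨ +-identityʳ a ⟨
    a + 0ℚ       ≤⟨ +-monoʳ-≤ a 0≤c ⟩
    a + c        ≡⟨ cong (λ x → a + x) eq ⟨
    a + (b - a)  ≡⟨ solve 2 (λ a b → a :+ (b :- a) := b) refl a b ⟩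
    b            ∎
    where open ≤-Reasoning

  0≤gap : ∀ {a b} → a ≤ b → 0ℚ ≤ b - a
  0≤gap {a} {b} a≤b = subst (_≤ b - a) (+-inverseʳ a) (+-monoˡ-≤ (- a) a≤b)

  0≤+ : ∀ {a b} → 0ℚ ≤ a → 0ℚ ≤ b → 0ℚ ≤ a + b
  0≤+ {a} {b} 0≤a 0≤b = +-mono-≤ {0ℚ} {a} {0ℚ} 0≤a 0≤b

  0≤* : ∀ {a b} → 0ℚ ≤ a → 0ℚ ≤ b → 0ℚ ≤ a * b
  0≤* {a} {b} 0≤a 0≤b = subst (_≤ a * b) (*-zeroʳ a) (*-monoˡ-≤-nonNeg a {{nonNegative 0≤a}} 0≤b)

  *-monoʳ-≤ : ∀ a {b c} → 0ℚ ≤ a → b ≤ c → a * b ≤ a * c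
  *-monoʳ-≤ a 0≤a b≤c = *-monoˡ-≤-nonNeg a {{nonNegative 0≤a}} b≤c

  0≤1 : 0ℚ ≤ 1ℚ
  0≤1 = nonNegative⁻¹ 1ℚ

  0≤^ : ∀ {a} k → 0ℚ ≤ a → 0ℚ ≤ a ^ k
  0≤^ zero    0≤a = 0≤1
  0≤^ (suc k) 0≤a = 0≤* 0≤a (0≤^ k 0≤a)

  -- Recursion over links is the form that the inductions need; `total-measure` identifies it with
  -- the defining sum.
  measure : ∀ {n} → ℚ → (Subset n → Bool) → ℚ
  measure {zero}  p f = if f [] then 1ℚ else 0ℚ
  measure {suc n} p f = p * measure p (f /ᶠ inside) + (1ℚ - p) * measure p (f /ᶠ outside)

  measure-∪∩ : ∀ {n} p (f g : Subset n → Bool) →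
    measure p (f ∪ᶠ g) + measure p (f ∩ᶠ g) ≡ measure p f + measure p g
  measure-∪∩ {zero} p f g with f [] | g []
  ... | true  | true  = refl
  ... | true  | false = refl
  ... | false | true  = refl
  ... | false | false = refl
  measure-∪∩ {suc n} p f g = begin
    (p * ∪₁ + (1ℚ - p) * ∪₀) + (p * ∩₁ + (1ℚ - p) * ∩₀)
      ≡⟨ solve 5 (λ p a b c d → (p :* a :+ (con 1ℚ :- p) :* b) :+ (p :* c :+ (con 1ℚ :- p) :* d)
           := p :* (a :+ c) :+ (con 1ℚ :- p) :* (b :+ d)) refl p ∪₁ ∪₀ ∩₁ ∩₀ ⟩
    p * (∪₁ + ∩₁) + (1ℚ - p) * (∪₀ + ∩₀)
      ≡⟨ cong₂ (λ a b → p * a + (1ℚ - p) * b)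
           (measure-∪∩ p (f /ᶠ inside) (g /ᶠ inside)) (measure-∪∩ p (f /ᶠ outside) (g /ᶠ outside)) ⟩
    p * (f₁ + g₁) + (1ℚ - p) * (f₀ + g₀)
      ≡⟨ solve 5 (λ p a b c d → p :* (a :+ c) :+ (con 1ℚ :- p) :* (b :+ d)
           := (p :* a :+ (con 1ℚ :- p) :* b) :+ (p :* c :+ (con 1ℚ :- p) :* d)) refl p f₁ f₀ g₁ g₀ ⟩
    (p * f₁ + (1ℚ - p) * f₀) + (p * g₁ + (1ℚ - p) * g₀) ∎
    where
    open ≡-Reasoning
    f₁ = measure p (f /ᶠ inside)
    f₀ = measure p (f /ᶠ outside)
    g₁ = measure p (g /ᶠ inside)
    g₀ = measure p (g /ᶠ outside)
    ∪₁ = measure p ((f ∪ᶠ g) /ᶠ inside)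
    ∪₀ = measure p ((f ∪ᶠ g) /ᶠ outside)
    ∩₁ = measure p ((f ∩ᶠ g) /ᶠ inside)
    ∩₀ = measure p ((f ∩ᶠ g) /ᶠ outside)

  measure-full : ∀ {n} p {f : Subset n → Bool} → (∀ A → A ∈ f) → measure p f ≡ 1ℚ
  measure-full {zero} p {f} h with f [] | h []
  ... | true | _ = refl
  measure-full {suc n} p {f} h
    rewrite measure-full p {f /ᶠ inside} (λ A → h (inside ∷ A)) | measure-full p {f /ᶠ outside} (λ A → h (outside ∷ A))
    = solve 1 (λ p → p :* con 1ℚ :+ (con 1ℚ :- p) :* con 1ℚ := con 1ℚ) refl p

  measure-empty : ∀ {n} p {f : Subset n → Bool} → (∀ {A} → ¬ A ∈ f) → measure p f ≡ 0ℚ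
  measure-empty {zero} p {f} h with f [] in eq
  ... | false = refl
  ... | true  = ⊥-elim (h {[]} (subst T (sym eq) tt))
  measure-empty {suc n} p {f} h
    rewrite measure-empty p {f /ᶠ inside} h | measure-empty p {f /ᶠ outside} h
    = solve 1 (λ p → p :* con 0ℚ :+ (con 1ℚ :- p) :* con 0ℚ := con 0ℚ) refl p

  module _ {p : ℚ} (0≤p : 0ℚ ≤ p) (p≤1 : p ≤ 1ℚ) where

    private
      0≤q : 0ℚ ≤ 1ℚ - p
      0≤q = 0≤gap p≤1

    measure-mono : ∀ {n} {f g : Subset n → Bool} → f ⊆ᶠ g → measure p f ≤ measure p g
    measure-mono {zero} {f} {g} f⊆g with f [] | g [] | f⊆g {[]}
    ... | false | false | _ = ≤-refl
    ... | false | true  | _ = 0≤1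
    ... | true  | true  | _ = ≤-refl
    ... | true  | false | h = ⊥-elim (h tt)
    measure-mono {suc n} f⊆g = +-mono-≤
      (*-monoʳ-≤ p 0≤p (measure-mono (λ {A} → f⊆g {inside ∷ A})))
      (*-monoʳ-≤ (1ℚ - p) 0≤q (measure-mono (λ {A} → f⊆g {outside ∷ A})))

    0≤measure : ∀ {n} (f : Subset n → Bool) → 0ℚ ≤ measure p f
    0≤measure {n} f = subst (_≤ measure p f) (measure-empty {n} p {λ _ → false} λ ())
      (measure-mono {n} {λ _ → false} {f} λ ())

    measure≤1 : ∀ {n} (f : Subset n → Bool) → measure p f ≤ 1ℚ
    measure≤1 {n} f = subst (measure p f ≤_) (measure-full {n} p {λ _ → true} λ _ → tt)
      (measure-mono {n} {f} {λ _ → true} λ _ → tt)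

  module _ {p : ℚ} (0≤p : 0ℚ ≤ p) (p≤q : p ≤ 1ℚ - p) where

    private
      0≤q : 0ℚ ≤ 1ℚ - p
      0≤q = ≤-trans 0≤p p≤q
      p≤1 : p ≤ 1ℚ
      p≤1 = ≤-gap 0≤q refl

    -- With C = f₀ ∪ g₁ and D = f₀ ∩ g₁ ⊇ g₀ for the links f₁, f₀, g₁, g₀ of f and g, both pairs
    -- f₁ ⊇ g₀ and C ⊇ D are again nested and cross-intersecting.
    nested-cross : ∀ {n} {f g : Subset n → Bool} → Upward f → Upward g → g ⊆ᶠ f →
      CrossIntersecting f g → p * measure p f + (1ℚ - p) * measure p g ≤ p
    nested-cross {zero} {f} {g} upf upg g⊆f cross with f [] in eqf | g [] in eqg
    ... | true  | true  = ⊥-elim (cross (subst T (sym eqf) tt) (subst T (sym eqg) tt) [])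
    ... | true  | false = ≤-reflexive (solve 1 (λ p → p :* con 1ℚ :+ (con 1ℚ :- p) :* con 0ℚ := p) refl p)
    ... | false | true  = ⊥-elim (subst T eqf (g⊆f {[]} (subst T (sym eqg) tt)))
    ... | false | false = subst (_≤ p) (solve 1 (λ p → con 0ℚ := p :* con 0ℚ :+ (con 1ℚ :- p) :* con 0ℚ) refl p) 0≤p
    nested-cross {suc n} {f} {g} upf upg g⊆f cross =
      ≤-gap (0≤+ (0≤+ (0≤* 0≤p (0≤gap ih₁)) (0≤* 0≤q (0≤gap ih₂)))
                 -- The hypothesis for C and D contains (q - p) D where only (q - p) g₀ is present;
                 -- the sign of q - p decides.
                 (0≤* (0≤* 0≤q (0≤gap p≤q)) (0≤gap g₀≤D)))
        (begin
          p - (p * (p * f₁ + (1ℚ - p) * f₀) + (1ℚ - p) * (p * g₁ + (1ℚ - p) * g₀))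
            ≡⟨ solve 5 (λ p f₁ f₀ g₁ g₀ →
                 p :- (p :* (p :* f₁ :+ (con 1ℚ :- p) :* f₀) :+ (con 1ℚ :- p) :* (p :* g₁ :+ (con 1ℚ :- p) :* g₀)) :=
                 p :- (p :* (p :* f₁ :+ (con 1ℚ :- p) :* g₀) :+ (con 1ℚ :- p) :* (p :* (f₀ :+ g₁) :+ (con 1ℚ :- p :- p) :* g₀)))
                 refl p f₁ f₀ g₁ g₀ ⟩
          p - (p * (p * f₁ + (1ℚ - p) * g₀) + (1ℚ - p) * (p * (f₀ + g₁) + (1ℚ - p - p) * g₀))
            ≡⟨ cong (λ s → p - (p * (p * f₁ + (1ℚ - p) * g₀) + (1ℚ - p) * (p * s + (1ℚ - p - p) * g₀)))
                 (measure-∪∩ p (f /ᶠ outside) (g /ᶠ inside)) ⟨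
          p - (p * (p * f₁ + (1ℚ - p) * g₀) + (1ℚ - p) * (p * (C + D) + (1ℚ - p - p) * g₀))
            ≡⟨ solve 5 (λ p f₁ g₀ C D →
                 p :- (p :* (p :* f₁ :+ (con 1ℚ :- p) :* g₀) :+ (con 1ℚ :- p) :* (p :* (C :+ D) :+ (con 1ℚ :- p :- p) :* g₀)) :=
                 p :* (p :- (p :* f₁ :+ (con 1ℚ :- p) :* g₀)) :+ (con 1ℚ :- p) :* (p :- (p :* C :+ (con 1ℚ :- p) :* D))
                   :+ (con 1ℚ :- p) :* (con 1ℚ :- p :- p) :* (D :- g₀))
                 refl p f₁ g₀ C D ⟩
          p * (p - (p * f₁ + (1ℚ - p) * g₀)) + (1ℚ - p) * (p - (p * C + (1ℚ - p) * D))
            + (1ℚ - p) * (1ℚ - p - p) * (D - g₀) ∎)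
      where
      open ≡-Reasoning
      f₁ = measure p (f /ᶠ inside)
      f₀ = measure p (f /ᶠ outside)
      g₁ = measure p (g /ᶠ inside)
      g₀ = measure p (g /ᶠ outside)
      C  = measure p ((f /ᶠ outside) ∪ᶠ (g /ᶠ inside))
      D  = measure p ((f /ᶠ outside) ∩ᶠ (g /ᶠ inside))
      ih₁ : p * f₁ + (1ℚ - p) * g₀ ≤ p
      ih₁ = nested-cross (Upward-/ {f = f} inside upf) (Upward-/ {f = g} outside upg)
        (λ {A} A∈ → upf (outside≼inside A) (g⊆f A∈)) (λ A∈ B∈ d → cross A∈ B∈ (tt ∷ d))
      up∪ : Upward ((f /ᶠ outside) ∪ᶠ (g /ᶠ inside))
      up∪ = Upward-∪ {f = f /ᶠ outside} {g /ᶠ inside} (Upward-/ {f = f} outside upf) (Upward-/ {f = g} inside upg)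
      up∩ : Upward ((f /ᶠ outside) ∩ᶠ (g /ᶠ inside))
      up∩ = Upward-∩ {f = f /ᶠ outside} {g /ᶠ inside} (Upward-/ {f = f} outside upf) (Upward-/ {f = g} inside upg)
      cross′ : CrossIntersecting ((f /ᶠ outside) ∪ᶠ (g /ᶠ inside)) ((f /ᶠ outside) ∩ᶠ (g /ᶠ inside))
      cross′ {A} {B} A∈ B∈ d with ∈∪⁻ (f (outside ∷ A)) A∈ | ∈∩⁻ (f (outside ∷ B)) B∈
      ... | inj₁ A∈f | _ , B∈g = cross A∈f B∈g (tt ∷ d)
      ... | inj₂ A∈g | B∈f , _ = cross B∈f A∈g (tt ∷ Disjoint-sym d)
      ih₂ : p * C + (1ℚ - p) * D ≤ p
      ih₂ = nested-cross up∪ up∩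
        (λ {A} A∈ → ∈∪ˡ (f (outside ∷ A)) (proj₁ (∈∩⁻ (f (outside ∷ A)) A∈))) (λ {A} {B} → cross′ {A} {B})
      g₀≤D : g₀ ≤ D
      g₀≤D = measure-mono 0≤p p≤1 λ {A} A∈ →
        ∈∩⁺ (f (outside ∷ A)) (g⊆f A∈) (upg (outside≼inside A) A∈)

    intersecting : ∀ {n} {f : Subset n → Bool} → Upward f → CrossIntersecting f f → measure p f ≤ p
    intersecting {f = f} up cross = subst (_≤ p)
      (solve 2 (λ p m → p :* m :+ (con 1ℚ :- p) :* m := m) refl p (measure p f))
      (nested-cross up up (λ A∈ → A∈) cross)

    -- A walk of the family reaches the line y = x + t, and beyond a first point of it the family is intersecting.
    pair-walks : ∀ {n ω} {f : Subset n → Bool} → 0ℚ ≤ ω → ω * (1ℚ - p) ≡ p → Upward f → ∀ t →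
      (∀ {A B} → A ∈ f → B ∈ f → ¬ (∀ i → count A i ℕ.+ count B i ℕ.≤ i ℕ.+ t)) →
      measure p f ≤ p * ω ^ t
    pair-walks {f = f} 0≤ω eq up zero pairs = subst (measure p f ≤_) (sym (*-identityʳ p))
      (intersecting up λ A∈ B∈ d → pairs A∈ B∈ λ i → ℕ.≤-trans (count-disjoint d i) (ℕ.m≤m+n i 0))
    pair-walks {zero} {ω} {f} 0≤ω eq up (suc t) pairs with f [] in eqf
    ... | false = 0≤* 0≤p (0≤^ (suc t) 0≤ω)
    ... | true  = ⊥-elim (pairs {[]} {[]} (subst T (sym eqf) tt) (subst T (sym eqf) tt) λ { zero → ℕ.z≤n ; (suc i) → ℕ.z≤n })
    pair-walks {suc n} {ω} {f} 0≤ω eq up (suc t) pairs = begin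
      p * measure p (f /ᶠ inside) + (1ℚ - p) * measure p (f /ᶠ outside)
        ≤⟨ +-mono-≤
             (*-monoʳ-≤ p 0≤p (pair-walks 0≤ω eq (Upward-/ {f = f} inside up) t λ A∈ B∈ h →
               pairs A∈ B∈ λ { zero → ℕ.z≤n ; (suc i) → step₁ i (h i) }))
             (*-monoʳ-≤ (1ℚ - p) 0≤q (pair-walks 0≤ω eq (Upward-/ {f = f} outside up) (suc (suc t)) λ A∈ B∈ h →
               pairs A∈ B∈ λ { zero → ℕ.z≤n ; (suc i) → ℕ.≤-trans (h i) (ℕ.≤-reflexive (ℕ.+-suc i (suc t))) })) ⟩
      -- ω = p / q is the probability that an infinite walk ever reaches y = x + 1, so p + q ω² = ω
      -- by its first step.
      p * (p * ω ^ t) + (1ℚ - p) * (p * (ω * (ω * ω ^ t)))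
        ≡⟨ solve 3 (λ p ω w → p :* (p :* w) :+ (con 1ℚ :- p) :* (p :* (ω :* (ω :* w)))
             := p :* w :* (p :+ ω :* (ω :* (con 1ℚ :- p)))) refl p ω (ω ^ t) ⟩
      p * ω ^ t * (p + ω * (ω * (1ℚ - p)))
        ≡⟨ cong (λ x → p * ω ^ t * (p + ω * x)) eq ⟩
      p * ω ^ t * (p + ω * p)
        ≡⟨ cong (λ x → p * ω ^ t * (x + ω * p)) eq ⟨
      p * ω ^ t * (ω * (1ℚ - p) + ω * p)
        ≡⟨ solve 3 (λ p ω w → p :* w :* (ω :* (con 1ℚ :- p) :+ ω :* p) := p :* (ω :* w)) refl p ω (ω ^ t) ⟩
      p * (ω * ω ^ t) ∎
      where
      open ≤-Reasoning
      step₁ : ∀ i {a b} → a ℕ.+ b ℕ.≤ i ℕ.+ t → suc a ℕ.+ suc b ℕ.≤ suc i ℕ.+ suc t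
      step₁ i {a} {b} h = ℕ.s≤s (subst₂ ℕ._≤_ (sym (ℕ.+-suc a b)) (sym (ℕ.+-suc i t)) (ℕ.s≤s h))

  -- Weighted passages and the bound for walks

  infix 9 ⟦_⟧

  ⟦_⟧ : ℕ → ℚ
  ⟦ n ⟧ = + n / 1

  toℚᵘ-⟦⟧ : ∀ n → toℚᵘ ⟦ n ⟧ ℚᵘ.≃ (+ n) ℚᵘ./ 1
  toℚᵘ-⟦⟧ n = toℚᵘ-fromℚᵘ ((+ n) ℚᵘ./ 1)

  ⟦⟧-+ : ∀ m n → ⟦ m ℕ.+ n ⟧ ≡ ⟦ m ⟧ + ⟦ n ⟧
  ⟦⟧-+ m n = toℚᵘ-injective (begin
    toℚᵘ ⟦ m ℕ.+ n ⟧                     ≈⟨ toℚᵘ-⟦⟧ (m ℕ.+ n) ⟩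
    + (m ℕ.+ n) ℚᵘ./ 1                    ≈⟨ ℚᵘ.*≡* (cong (ℤ._* + 1) (sym (cong₂ ℤ._+_ (ℤ.*-identityʳ (+ m)) (ℤ.*-identityʳ (+ n))))) ⟩
    (+ m) ℚᵘ./ 1 ℚᵘ.+ (+ n) ℚᵘ./ 1        ≈⟨ ℚᵘ.+-cong (toℚᵘ-⟦⟧ m) (toℚᵘ-⟦⟧ n) ⟨
    toℚᵘ ⟦ m ⟧ ℚᵘ.+ toℚᵘ ⟦ n ⟧            ≈⟨ toℚᵘ-homo-+ ⟦ m ⟧ ⟦ n ⟧ ⟨
    toℚᵘ (⟦ m ⟧ + ⟦ n ⟧)                  ∎)
    where open ℚᵘ.≃-Reasoning

  ⟦⟧-mono : ∀ {m n} → m ℕ.≤ n → ⟦ m ⟧ ≤ ⟦ n ⟧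
  ⟦⟧-mono {m} {n} m≤n = toℚᵘ-cancel-≤ (begin
    toℚᵘ ⟦ m ⟧        ≃⟨ toℚᵘ-⟦⟧ m ⟩
    (+ m) ℚᵘ./ 1      ≤⟨ ℚᵘ.*≤* (ℤ.*-monoʳ-≤-nonNeg (+ 1) (ℤ.+≤+ m≤n)) ⟩
    (+ n) ℚᵘ./ 1      ≃⟨ toℚᵘ-⟦⟧ n ⟨
    toℚᵘ ⟦ n ⟧        ∎)
    where open ℚᵘ.≤-Reasoning

  8⟦⟧ : ∀ n → ⟦ 8 ℕ.* n ⟧ ≡ ⟦ 8 ⟧ * ⟦ n ⟧
  8⟦⟧ n = begin
    ⟦ 8 ℕ.* n ⟧  ≡⟨ eight n 8 ⟩
    times 8 ⟦ n ⟧ ≡⟨ solve 1 (λ x → x :+ (x :+ (x :+ (x :+ (x :+ (x :+ (x :+ (x :+ con 0ℚ))))))) := con ⟦ 8 ⟧ :* x) refl ⟦ n ⟧ ⟩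
    ⟦ 8 ⟧ * ⟦ n ⟧ ∎
    where
    open ≡-Reasoning
    times : ℕ → ℚ → ℚ
    times zero    x = 0ℚ
    times (suc m) x = x + times m x
    eight : ∀ n m → ⟦ m ℕ.* n ⟧ ≡ times m ⟦ n ⟧
    eight n zero    = refl
    eight n (suc m) = trans (⟦⟧-+ n (m ℕ.* n)) (cong (λ x → ⟦ n ⟧ + x) (eight n m))

  -- The value of p²q at p = 1/2, its maximum on the range of p.
  ⅛ : ℚ
  ⅛ = + 1 / 8

  0≤⅛ : 0ℚ ≤ ⅛
  0≤⅛ = nonNegative⁻¹ ⅛

  ⅛^ : ∀ k → ⟦ 8 ℕ.^ k ⟧ * ⅛ ^ k ≡ 1ℚ
  ⅛^ zero    = refl
  ⅛^ (suc k) = begin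
    ⟦ 8 ℕ.* 8 ℕ.^ k ⟧ * (⅛ * ⅛ ^ k)      ≡⟨ cong (_* (⅛ * ⅛ ^ k)) (8⟦⟧ (8 ℕ.^ k)) ⟩
    ⟦ 8 ⟧ * ⟦ 8 ℕ.^ k ⟧ * (⅛ * ⅛ ^ k)    ≡⟨ solve 2 (λ x y → con ⟦ 8 ⟧ :* x :* (con ⅛ :* y) := x :* y) refl ⟦ 8 ℕ.^ k ⟧ (⅛ ^ k) ⟩
    ⟦ 8 ℕ.^ k ⟧ * ⅛ ^ k                  ≡⟨ ⅛^ k ⟩
    1ℚ                                   ∎
    where open ≡-Reasoning

  -- For the generating series of `passages` at 1/8, `passing k t` is the k-th term and `before k t`
  -- the sum of the terms below k.
  passing before : ℕ → ℕ → ℚ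
  passing k t = ⟦ passages k t ⟧ * ⅛ ^ k
  before  k t = ⟦ earlier k t ⟧ * ⅛ ^ k

  scaled-+ : ∀ m n k → ⟦ m ℕ.+ n ⟧ * ⅛ ^ suc k ≡ ⟦ m ⟧ * ⅛ ^ suc k + ⅛ * (⟦ n ⟧ * ⅛ ^ k)
  scaled-+ m n k = trans (cong (_* ⅛ ^ suc k) (⟦⟧-+ m n))
    (solve 3 (λ x y z → (x :+ y) :* (con ⅛ :* z) := x :* (con ⅛ :* z) :+ con ⅛ :* (y :* z)) refl ⟦ m ⟧ ⟦ n ⟧ (⅛ ^ k))

  passing-suc : ∀ k t → passing (suc k) (suc t) ≡ passing (suc k) t + ⅛ * passing k (3 ℕ.+ t)
  passing-suc k t = scaled-+ (passages (suc k) t) (passages k (3 ℕ.+ t)) k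

  before-suc : ∀ k t → before (suc k) (suc t) ≡ before (suc k) t + ⅛ * before k (3 ℕ.+ t)
  before-suc k t = scaled-+ (earlier (suc k) t) (earlier k (3 ℕ.+ t)) k

  before-0 : ∀ k → before (suc k) 0 ≡ 1ℚ
  before-0 k = ⅛^ (suc k)

  0≤passing : ∀ k t → 0ℚ ≤ passing k t
  0≤passing k t = 0≤* (⟦⟧-mono {0} {passages k t} ℕ.z≤n) (0≤^ k 0≤⅛)

  0≤before : ∀ k t → 0ℚ ≤ before k t
  0≤before k t = 0≤* (⟦⟧-mono {0} {earlier k t} ℕ.z≤n) (0≤^ k 0≤⅛)

  module _ {p : ℚ} (0≤p : 0ℚ ≤ p) (p≤q : p ≤ 1ℚ - p) (p²q≤⅛ : (1ℚ - p) * (p * p) ≤ ⅛) where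

    private
      0≤q : 0ℚ ≤ 1ℚ - p
      0≤q = ≤-trans 0≤p p≤q
      p≤1 : p ≤ 1ℚ
      p≤1 = ≤-gap 0≤q refl

    -- Reaching the line after j steps right takes 2j + t steps up, of total weight at most p ^ t
    -- times 8 to the power -j. What follows contributes a factor p if j < k, by intersection, and 1
    -- if j = k.
    walkBound : ℕ → ℕ → ℚ
    walkBound k t = p ^ t * (p * before k t + passing k t)

    0≤walkBound : ∀ k t → 0ℚ ≤ walkBound k t
    0≤walkBound k t = 0≤* (0≤^ t 0≤p) (0≤+ (0≤* 0≤p (0≤before k t)) (0≤passing k t))

    -- Beyond a first point of the line y = 2x + t reached in fewer than k steps right, the family is intersecting.
    walks : ∀ {n} {f : Subset n → Bool} → Upward f → ∀ t k →
      (∀ {A B} → A ∈ f → B ∈ f → ¬ Parts t k A B) → (∀ {A} → A ∈ f → ¬ Misses t k A) →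
      measure p f ≤ walkBound k t
    -- With no steps right left there is no `fork`, so only the trivial bound 1 remains.
    walks {f = f} up zero zero parts misses = ≤-trans (measure≤1 0≤p p≤1 f) (≤-reflexive
      (solve 1 (λ p → con 1ℚ := con 1ℚ :* (p :* (con 0ℚ :* con 1ℚ) :+ con 1ℚ :* con 1ℚ)) refl p))
    walks {f = f} up zero (suc k) parts misses = ≤-trans
      (intersecting 0≤p p≤q up λ A∈ B∈ d → parts A∈ B∈ (fork d))
      (≤-reflexive (begin
        p                                                       ≡⟨ solve 2 (λ p x → p := con 1ℚ :* (p :* con 1ℚ :+ con 0ℚ :* x)) refl p (⅛ ^ suc k) ⟩
        1ℚ * (p * 1ℚ + passing (suc k) 0)                       ≡⟨ cong (λ x → 1ℚ * (p * x + passing (suc k) 0)) (before-0 k) ⟨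
        1ℚ * (p * before (suc k) 0 + passing (suc k) 0)         ∎))
      where open ≡-Reasoning
    walks {zero} {f} up (suc t) k parts misses =
      subst (_≤ walkBound k (suc t)) (sym (measure-empty p {f} λ { {[]} A∈ → misses A∈ end })) (0≤walkBound k (suc t))
    walks {suc n} {f} up (suc t) zero parts misses = begin
      p * measure p (f /ᶠ inside) + (1ℚ - p) * measure p (f /ᶠ outside)
        ≡⟨ cong (λ x → p * measure p (f /ᶠ inside) + (1ℚ - p) * x)
             (measure-empty p {f /ᶠ outside} λ A∈ → misses A∈ exhaust) ⟩
      p * measure p (f /ᶠ inside) + (1ℚ - p) * 0ℚ
        ≤⟨ +-monoˡ-≤ ((1ℚ - p) * 0ℚ) (*-monoʳ-≤ p 0≤p
             (walks (Upward-/ {f = f} inside up) t zero (λ A∈ B∈ m → parts A∈ B∈ (rise m)) (λ A∈ m → misses A∈ (rise m)))) ⟩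
      p * walkBound zero t + (1ℚ - p) * 0ℚ
        ≡⟨ solve 2 (λ p w → p :* (w :* (p :* (con 0ℚ :* con 1ℚ) :+ con 1ℚ :* con 1ℚ)) :+ (con 1ℚ :- p) :* con 0ℚ
             := p :* w :* (p :* (con 0ℚ :* con 1ℚ) :+ con 1ℚ :* con 1ℚ)) refl p (p ^ t) ⟩
      walkBound zero (suc t) ∎
      where open ≤-Reasoning
    walks {suc n} {f} up (suc t) (suc k) parts misses = begin
      p * measure p (f /ᶠ inside) + (1ℚ - p) * measure p (f /ᶠ outside)
        ≤⟨ +-mono-≤
             (*-monoʳ-≤ p 0≤p (walks (Upward-/ {f = f} inside up) t (suc k)
               (λ A∈ B∈ m → parts A∈ B∈ (rise m)) (λ A∈ m → misses A∈ (rise m))))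
             (*-monoʳ-≤ (1ℚ - p) 0≤q (walks (Upward-/ {f = f} outside up) (3 ℕ.+ t) k
               (λ A∈ B∈ m → parts A∈ B∈ (run m)) (λ A∈ m → misses A∈ (run m)))) ⟩
      p * walkBound (suc k) t + (1ℚ - p) * walkBound k (3 ℕ.+ t)
        ≡⟨ solve 4 (λ p w x y → p :* (w :* x) :+ (con 1ℚ :- p) :* (p :* (p :* (p :* w)) :* y)
             := p :* w :* (x :+ (con 1ℚ :- p) :* (p :* p) :* y)) refl p (p ^ t) x y ⟩
      p ^ suc t * (x + (1ℚ - p) * (p * p) * y)
        ≤⟨ *-monoʳ-≤ (p ^ suc t) (0≤^ (suc t) 0≤p) (+-monoʳ-≤ x
             (*-monoʳ-≤-nonNeg y {{nonNegative (0≤+ (0≤* 0≤p (0≤before k (3 ℕ.+ t))) (0≤passing k (3 ℕ.+ t)))}} p²q≤⅛)) ⟩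
      p ^ suc t * (x + ⅛ * y)
        ≡⟨ cong (p ^ suc t *_) (solve 5 (λ p a b c d → p :* a :+ b :+ con ⅛ :* (p :* c :+ d)
             := p :* (a :+ con ⅛ :* c) :+ (b :+ con ⅛ :* d)) refl p
             (before (suc k) t) (passing (suc k) t) (before k (3 ℕ.+ t)) (passing k (3 ℕ.+ t))) ⟩
      p ^ suc t * (p * (before (suc k) t + ⅛ * before k (3 ℕ.+ t)) + (passing (suc k) t + ⅛ * passing k (3 ℕ.+ t)))
        ≡⟨ cong₂ (λ a b → p ^ suc t * (p * a + b)) (before-suc k t) (passing-suc k t) ⟨
      walkBound (suc k) (suc t) ∎
      where
      open ≤-Reasoning
      x = p * before (suc k) t + passing (suc k) t
      y = p * before k (3 ℕ.+ t) + passing k (3 ℕ.+ t)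

  -- Slightly above √5 - 1, a fixed point of x ↦ 1 + x³ / 8.
  β : ℚ
  β = + 89 / 72

  -- Since 1 + β³ / 8 ≤ β, the powers of β are a supersolution of the first-step recursion.
  before+passing : ∀ k t → before k t + passing k t ≤ β ^ t
  before+passing zero t = 1≤β^ t
    where
    1≤β^ : ∀ t → 1ℚ ≤ β ^ t
    1≤β^ zero    = ≤-refl
    1≤β^ (suc t) = begin
      1ℚ        ≤⟨ toWitness {a? = 1ℚ ≤? β} tt ⟩
      β         ≡⟨ *-identityʳ β ⟨
      β * 1ℚ    ≤⟨ *-monoʳ-≤ β (nonNegative⁻¹ β) (1≤β^ t) ⟩
      β * β ^ t ∎
      where open ≤-Reasoning
  before+passing (suc k) zero = ≤-reflexive
    (trans (cong (_+ passing (suc k) 0) (before-0 k)) (solve 1 (λ x → con 1ℚ :+ con 0ℚ :* x := con 1ℚ) refl (⅛ ^ suc k)))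
  before+passing (suc k) (suc t) = begin
    before (suc k) (suc t) + passing (suc k) (suc t)
      ≡⟨ cong₂ _+_ (before-suc k t) (passing-suc k t) ⟩
    (before (suc k) t + ⅛ * before k (3 ℕ.+ t)) + (passing (suc k) t + ⅛ * passing k (3 ℕ.+ t))
      ≡⟨ solve 4 (λ a b c d → (a :+ con ⅛ :* c) :+ (b :+ con ⅛ :* d) := (a :+ b) :+ con ⅛ :* (c :+ d)) refl
           (before (suc k) t) (passing (suc k) t) (before k (3 ℕ.+ t)) (passing k (3 ℕ.+ t)) ⟩
    (before (suc k) t + passing (suc k) t) + ⅛ * (before k (3 ℕ.+ t) + passing k (3 ℕ.+ t))
      ≤⟨ +-mono-≤ (before+passing (suc k) t) (*-monoʳ-≤ ⅛ 0≤⅛ (before+passing k (3 ℕ.+ t))) ⟩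
    β ^ t + ⅛ * β ^ (3 ℕ.+ t)
      ≡⟨ solve 1 (λ x → x :+ con ⅛ :* (con β :* (con β :* (con β :* x))) := con (1ℚ + ⅛ * (β * (β * β))) :* x) refl (β ^ t) ⟩
    (1ℚ + ⅛ * (β * (β * β))) * β ^ t
      ≤⟨ *-monoʳ-≤-nonNeg (β ^ t) {{nonNegative (0≤^ t (nonNegative⁻¹ β))}}
           (toWitness {a? = (1ℚ + ⅛ * (β * (β * β))) ≤? β} tt) ⟩
    β * β ^ t ∎
    where open ≤-Reasoning

  passing-anti : ∀ k → passing (suc k) 3 ≤ passing k 3
  passing-anti k = begin
    ⟦ passages (suc k) 3 ⟧ * (⅛ * ⅛ ^ k)
      ≤⟨ *-monoʳ-≤-nonNeg (⅛ * ⅛ ^ k) {{nonNegative (0≤^ (suc k) 0≤⅛)}} (⟦⟧-mono (passages-growth k)) ⟩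
    ⟦ 8 ℕ.* passages k 3 ⟧ * (⅛ * ⅛ ^ k)
      ≡⟨ cong (_* (⅛ * ⅛ ^ k)) (8⟦⟧ (passages k 3)) ⟩
    ⟦ 8 ⟧ * ⟦ passages k 3 ⟧ * (⅛ * ⅛ ^ k)
      ≡⟨ solve 2 (λ x y → con ⟦ 8 ⟧ :* x :* (con ⅛ :* y) := x :* y) refl ⟦ passages k 3 ⟧ (⅛ ^ k) ⟩
    ⟦ passages k 3 ⟧ * ⅛ ^ k ∎
    where open ≤-Reasoning

  -- The heights still to climb after the prefixes 0110, 010 and 00 are 3, 4 and 5.
  before₃ passing₃ : ℕ → ℚ
  before₃  k = before k 3 + before k 4 + before k 5
  passing₃ k = passing k 3 + passing k 4 + passing k 5

  -- The recursion at height 3, unrolled down to height 0, where the term vanishes. Thus one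
  -- decreasing sequence controls all three heights.
  passing₃-suc : ∀ k → passing₃ k ≡ ⟦ 8 ⟧ * passing (suc k) 3
  passing₃-suc k = begin
    passing k 3 + passing k 4 + passing k 5
      ≡⟨ solve 4 (λ x y z w → x :+ y :+ z := con ⟦ 8 ⟧ :* (con 0ℚ :* w :+ con ⅛ :* x :+ con ⅛ :* y :+ con ⅛ :* z))
           refl (passing k 3) (passing k 4) (passing k 5) (⅛ ^ suc k) ⟩
    ⟦ 8 ⟧ * (passing (suc k) 0 + ⅛ * passing k 3 + ⅛ * passing k 4 + ⅛ * passing k 5)
      ≡⟨ cong (λ x → ⟦ 8 ⟧ * (x + ⅛ * passing k 4 + ⅛ * passing k 5)) (passing-suc k 0) ⟨
    ⟦ 8 ⟧ * (passing (suc k) 1 + ⅛ * passing k 4 + ⅛ * passing k 5)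
      ≡⟨ cong (λ x → ⟦ 8 ⟧ * (x + ⅛ * passing k 5)) (passing-suc k 1) ⟨
    ⟦ 8 ⟧ * (passing (suc k) 2 + ⅛ * passing k 5)
      ≡⟨ cong (λ x → ⟦ 8 ⟧ * x) (passing-suc k 2) ⟨
    ⟦ 8 ⟧ * passing (suc k) 3 ∎
    where open ≡-Reasoning

  passing-tail : ∀ j → passing (j ℕ.+ 8) 3 ≤ passing 8 3
  passing-tail zero    = ≤-refl
  passing-tail (suc j) = ≤-trans (passing-anti (j ℕ.+ 8)) (passing-tail j)

  ⅖ : ℚ
  ⅖ = + 2 / 5

  module _ {p : ℚ} (⅖≤p : ⅖ ≤ p) (p≤½ : p ≤ ½) where

    -- Both sides are affine in p, so the two endpoints suffice; 10 is the inverse of the length of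
    -- [2/5, 1/2].
    linear : ∀ a b c d → ⅖ * a + b ≤ ⅖ * c + d → ½ * a + b ≤ ½ * c + d → p * a + b ≤ p * c + d
    linear a b c d h h′ = ≤-gap
      (0≤* (nonNegative⁻¹ (+ 10 / 1)) (0≤+ (0≤* (0≤gap p≤½) (0≤gap h)) (0≤* (0≤gap ⅖≤p) (0≤gap h′))))
      (solve 5 (λ p a b c d → (p :* c :+ d) :- (p :* a :+ b) :=
        con (+ 10 / 1) :* ((con ½ :- p) :* ((con ⅖ :* c :+ d) :- (con ⅖ :* a :+ b)) :+
                           (p :- con ⅖) :* ((con ½ :* c :+ d) :- (con ½ :* a :+ b)))) refl p a b c d)

    private
      slope offset K : ℚ
      -- The majorant is 3 at p = 2/5, attained by k = 0, and 3.62 at p = 1/2, just above the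
      -- estimate there for k ≥ 7.
      slope = + 31 / 5
      offset = + 13 / 25
      K     = β ^ 3 + β ^ 4 + β ^ 5

      small : ∀ k → True (⅖ * before₃ k + passing₃ k ≤? ⅖ * slope + offset) →
        True (½ * before₃ k + passing₃ k ≤? ½ * slope + offset) → p * before₃ k + passing₃ k ≤ p * slope + offset
      small k h h′ = linear (before₃ k) (passing₃ k) slope offset (toWitness h) (toWitness h′)

    -- The majorant is linear in p; for k ≥ 7, passing₃ k is at most its value at 7 and
    -- before₃ k + passing₃ k at most K.
    few-steps : ∀ k → p * before₃ k + passing₃ k ≤ p * slope + offset
    few-steps 0 = small 0 tt tt
    few-steps 1 = small 1 tt tt
    few-steps 2 = small 2 tt tt
    few-steps 3 = small 3 tt tt
    few-steps 4 = small 4 tt tt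
    few-steps 5 = small 5 tt tt
    few-steps 6 = small 6 tt tt
    few-steps (suc (suc (suc (suc (suc (suc (suc j))))))) = begin
      p * a + c               ≡⟨ solve 3 (λ p a c → p :* a :+ c := p :* (a :+ c) :+ (con 1ℚ :- p) :* c) refl p a c ⟩
      p * (a + c) + (1ℚ - p) * c
        ≤⟨ +-mono-≤ (*-monoʳ-≤ p 0≤p a+c≤K) (*-monoʳ-≤ (1ℚ - p) (0≤gap p≤1) c≤C) ⟩
      p * K + (1ℚ - p) * C    ≡⟨ solve 3 (λ p K C → p :* K :+ (con 1ℚ :- p) :* C := p :* (K :- C) :+ C) refl p K C ⟩
      p * (K - C) + C
        ≤⟨ linear (K - C) C slope offset (toWitness {a? = ⅖ * (K - C) + C ≤? ⅖ * slope + offset} tt)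
                                        (toWitness {a? = ½ * (K - C) + C ≤? ½ * slope + offset} tt) ⟩
      p * slope + offset       ∎
      where
      open ≤-Reasoning
      k = 7 ℕ.+ j
      a = before₃ k
      c = passing₃ k
      C = ⟦ 8 ⟧ * passing 8 3
      0≤p : 0ℚ ≤ p
      0≤p = ≤-trans (nonNegative⁻¹ ⅖) ⅖≤p
      p≤1 : p ≤ 1ℚ
      p≤1 = ≤-trans p≤½ (toWitness {a? = ½ ≤? 1ℚ} tt)
      a+c≤K : a + c ≤ K
      a+c≤K = begin
        a + c
          ≡⟨ solve 6 (λ a b c d e f → (a :+ b :+ c) :+ (d :+ e :+ f) := (a :+ d) :+ (b :+ e) :+ (c :+ f)) refl
               (before k 3) (before k 4) (before k 5) (passing k 3) (passing k 4) (passing k 5) ⟩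
        (before k 3 + passing k 3) + (before k 4 + passing k 4) + (before k 5 + passing k 5)
          ≤⟨ +-mono-≤ (+-mono-≤ (before+passing k 3) (before+passing k 4)) (before+passing k 5) ⟩
        K ∎
      c≤C : c ≤ C
      c≤C = begin
        c                          ≡⟨ passing₃-suc k ⟩
        ⟦ 8 ⟧ * passing (suc k) 3  ≤⟨ *-monoʳ-≤ ⟦ 8 ⟧ (nonNegative⁻¹ ⟦ 8 ⟧) (subst (λ k → passing k 3 ≤ passing 8 3) (ℕ.+-comm j 8) (passing-tail j)) ⟩
        C                          ∎

  -- The two cases for rational p

  -- Ceilings for the third member: `capI` if it is outside `BD₃`, `capII` if it omits 1 and a
  -- second element of [4], `cap₀` if it omits 1.
  capI capII : ℕ → ℕ
  capI 0 = 0
  capI 1 = 1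
  capI _ = 2
  capII 0 = 0
  capII 1 = 0
  capII 2 = 1
  capII _ = 2

  cap₀ : ℕ → ℕ
  cap₀ 0 = 0
  cap₀ (suc i) = i

  capI-bounded : ∀ {n} {F : Subset n} → count F 4 ℕ.≤ 2 → BoundedBy F capI 4
  capI-bounded h 0 _ = z≤n
  capI-bounded {F = F} h 1 _ = count≤ F 1
  capI-bounded {F = F} h 2 _ = count≤ F 2
  capI-bounded {F = F} h 3 _ = ℕ.≤-trans (count-mono F 3 1) h
    where
    count-mono : ∀ {n} (F : Subset n) i j → count F i ℕ.≤ count F (i ℕ.+ j)
    count-mono F             zero    j = z≤n
    count-mono []            (suc i) j = z≤n
    count-mono (inside  ∷ F) (suc i) j = s≤s (count-mono F i j)
    count-mono (outside ∷ F) (suc i) j = count-mono F i j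
  capI-bounded h 4 _ = h
  capI-bounded h (suc (suc (suc (suc (suc i))))) (s≤s (s≤s (s≤s (s≤s ()))))

  capII-bounded : ∀ {n} {L : Subset n} → count L 3 ℕ.≤ 2 → BoundedBy (outside ∷ L) capII 4
  capII-bounded h 0 _ = z≤n
  capII-bounded h 1 _ = z≤n
  capII-bounded {L = L} h 2 _ = count≤ L 1
  capII-bounded {L = L} h 3 _ = count≤ L 2
  capII-bounded h 4 _ = h
  capII-bounded h (suc (suc (suc (suc (suc i))))) (s≤s (s≤s (s≤s (s≤s ()))))

  restrict : ∀ {n} {F : Subset n} {cap m k} → k ℕ.≤ m → BoundedBy F cap m → BoundedBy F cap k
  restrict k≤m h i i≤k = h i (ℕ.≤-trans i≤k k≤m)

  late-1 : ∀ {n} {L : Subset n} → count L 3 ℕ.≤ 2 → Late 1 L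
  late-1 {L = L} h 0 = inj₁ z≤n
  late-1 {L = L} h 1 = inj₁ (ℕ.≤-trans (ℕ.*-monoˡ-≤ 3 (count≤ L 1)) (ℕ.n≤1+n 3))
  late-1 {L = L} h 2 = inj₁ (ℕ.*-monoˡ-≤ 3 (count≤ L 2))
  late-1 {L = L} h (suc (suc (suc j))) = inj₂ (ℕ.≤-trans (ℕ.≤-reflexive (ℕ.+-comm (count L (3 ℕ.+ j)) 1))
    (s≤s (ℕ.≤-trans (count-+ L 3 j) (ℕ.+-monoˡ-≤ j h))))

  module _ {p : ℚ} (⅖≤p : ⅖ ≤ p) (p≤½ : p ≤ ½) where

    private
      q : ℚ
      q = 1ℚ - p

      0≤p : 0ℚ ≤ p
      0≤p = ≤-trans (nonNegative⁻¹ ⅖) ⅖≤p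

      p≤q : p ≤ q
      p≤q = ≤-gap (0≤* (nonNegative⁻¹ (+ 2 / 1)) (0≤gap p≤½))
        (solve 1 (λ p → con 1ℚ :- p :- p := con (+ 2 / 1) :* (con ½ :- p)) refl p)

      0≤q : 0ℚ ≤ q
      0≤q = ≤-trans 0≤p p≤q

      p≤1 : p ≤ 1ℚ
      p≤1 = ≤-gap 0≤q refl

      p²q≤⅛ : q * (p * p) ≤ ⅛
      p²q≤⅛ = ≤-gap (0≤* (0≤gap p≤½) (0≤+ (0≤* 0≤p (0≤gap p≤½)) (nonNegative⁻¹ (+ 1 / 4))))
        (solve 1 (λ p → con ⅛ :- (con 1ℚ :- p) :* (p :* p) := (con ½ :- p) :* (p :* (con ½ :- p) :+ con (+ 1 / 4))) refl p)

    module _ {m} {f : Subset (4 ℕ.+ m) → Bool} (up : Upward f) (triples : Triples f) where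

      private
        G : ∀ {n} → (Subset n → Bool) → ℚ
        G = measure p

        nested : ∀ {k n} {f : Subset (k ℕ.+ n) → Bool} → Upward f → Triples f → ∀ {F} → F ∈ f → ∀ {cap} → BoundedBy F cap k →
          (u v : Subset k) → True (v ≼? u) → True (fits? cap u v) →
          p * G (prefixed {k} u f) + q * G (prefixed {k} v f) ≤ p
        nested {k} {f = f} up triples F∈ F≤cap u v v≼u fits = nested-cross 0≤p p≤q
          (Upward-prefixed {k} {f = f} u up) (Upward-prefixed {k} {f = f} v up)
          (λ {A} → up (++-≼ {u = v} {u} {A} (toWitness v≼u)))
          (λ {A} {B} → fits-cross {k} {f = f} triples F∈ F≤cap u v fits {A} {B})

        single : ∀ {k n} {f : Subset (k ℕ.+ n) → Bool} → Upward f → Triples f → ∀ {F} → F ∈ f → ∀ {cap} → BoundedBy F cap k →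
          (u : Subset k) → True (fits? cap u u) → G (prefixed {k} u f) ≤ p
        single {k} {f = f} up triples F∈ F≤cap u fits = intersecting 0≤p p≤q
          (Upward-prefixed {k} {f = f} u up)
          (λ {A} {B} → fits-cross {k} {f = f} triples F∈ F≤cap u u fits {A} {B})

      -- The links at 00, 010 and 0110 are empty. A member omitting 1 makes f(1) intersecting, and
      -- the member outside `BD₃` does the same for f(0111), as its counts fit beside twice those of
      -- 0111.
      case-I : ∀ {L} → L ∈ f /ᶠ outside → ∀ {F} → F ∈ f → count F 4 ℕ.≤ 2 →
        (∀ {A} → A ∈ f /ᶠ outside → ¬ count A 3 ℕ.≤ 2) → G f ≤ p * p + q * (p * (p * (p * p)))
      case-I {L} L∈ {F} F∈ F≤2 only = begin
        p * G (f /ᶠ inside) + q * (p * (p * (p * X + q * r₁) + q * r₂) + q * r₃)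
          ≡⟨ cong (λ s → p * G (f /ᶠ inside) + q * s) (begin-equality
               p * (p * (p * X + q * r₁) + q * r₂) + q * r₃
                 ≡⟨ cong₂ (λ a b → p * (p * (p * X + q * a) + q * b) + q * r₃) r₁≡0 r₂≡0 ⟩
               p * (p * (p * X + q * 0ℚ) + q * 0ℚ) + q * r₃
                 ≡⟨ cong (λ a → p * (p * (p * X + q * 0ℚ) + q * 0ℚ) + q * a) r₃≡0 ⟩
               p * (p * (p * X + q * 0ℚ) + q * 0ℚ) + q * 0ℚ
                 ≡⟨ solve 3 (λ p q x → p :* (p :* (p :* x :+ q :* con 0ℚ) :+ q :* con 0ℚ) :+ q :* con 0ℚ := p :* (p :* (p :* x))) refl p q X ⟩
               p * (p * (p * X)) ∎) ⟩
        p * G (f /ᶠ inside) + q * (p * (p * (p * X)))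
          ≤⟨ +-mono-≤ (*-monoʳ-≤ p 0≤p G≤p) (*-monoʳ-≤ q 0≤q (*-monoʳ-≤ p 0≤p (*-monoʳ-≤ p 0≤p (*-monoʳ-≤ p 0≤p X≤p)))) ⟩
        p * p + q * (p * (p * (p * p))) ∎
        where
        open ≤-Reasoning
        X = G (prefixed {4} {m} (outside ∷ inside ∷ inside ∷ inside ∷ []) f)
        r₁ = G (f /ᶠ outside /ᶠ inside /ᶠ inside /ᶠ outside)
        r₂ = G (f /ᶠ outside /ᶠ inside /ᶠ outside)
        r₃ = G (f /ᶠ outside /ᶠ outside)
        r₁≡0 : r₁ ≡ 0ℚ
        r₁≡0 = measure-empty p {f /ᶠ outside /ᶠ inside /ᶠ inside /ᶠ outside} λ {A} A∈ → only {inside ∷ inside ∷ outside ∷ A} A∈ ℕ.≤-refl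
        r₂≡0 : r₂ ≡ 0ℚ
        r₂≡0 = measure-empty p {f /ᶠ outside /ᶠ inside /ᶠ outside} λ {A} A∈ → only {inside ∷ outside ∷ A} A∈ (s≤s (count≤ A 1))
        r₃≡0 : r₃ ≡ 0ℚ
        r₃≡0 = measure-empty p {f /ᶠ outside /ᶠ outside} λ {A} A∈ → only {outside ∷ A} A∈ (count≤ A 2)
        G≤p : G (f /ᶠ inside) ≤ p
        G≤p = single {1} {f = f} up triples L∈ {cap₀} (λ { 0 _ → z≤n ; 1 _ → z≤n ; (suc (suc i)) (s≤s ()) }) (inside ∷ []) tt
        X≤p : X ≤ p
        X≤p = single {4} {f = f} up triples F∈ {capI} (capI-bounded F≤2) (outside ∷ inside ∷ inside ∷ inside ∷ []) tt

      module CaseII {L} (L∈ : L ∈ f /ᶠ outside) (L≤2 : count L 3 ℕ.≤ 2) {ω} (0≤ω : 0ℚ ≤ ω) (ωq≡p : ω * q ≡ p) where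

        private
          capped : BoundedBy (outside ∷ L) capII 4
          capped = capII-bounded L≤2
          capped₃ : BoundedBy (outside ∷ L) capII 3
          capped₃ = restrict (ℕ.n≤1+n 3) capped

          a b c d x r₁ r₂ r₃ : ℚ
          a = G (prefixed {3} (inside ∷ inside ∷ inside ∷ []) f)
          b = G (prefixed {3} (inside ∷ inside ∷ outside ∷ []) f)
          c = G (prefixed {3} (inside ∷ outside ∷ inside ∷ []) f)
          d = G (prefixed {3} (inside ∷ outside ∷ outside ∷ []) f)
          x = G (prefixed {4} (outside ∷ inside ∷ inside ∷ inside ∷ []) f)
          r₁ = G (f /ᶠ outside /ᶠ inside /ᶠ inside /ᶠ outside)
          r₂ = G (f /ᶠ outside /ᶠ inside /ᶠ outside)
          r₃ = G (f /ᶠ outside /ᶠ outside)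

        ad≤p : p * a + q * d ≤ p
        ad≤p = nested {3} {f = f} up triples L∈ capped₃ (inside ∷ inside ∷ inside ∷ []) (inside ∷ outside ∷ outside ∷ []) tt tt

        bc≤p : p * b + q * c ≤ p
        bc≤p = nested {3} {f = f} up triples L∈ capped₃ (inside ∷ inside ∷ outside ∷ []) (inside ∷ outside ∷ inside ∷ []) tt tt

        bd≤p : p * b + q * d ≤ p
        bd≤p = nested {3} {f = f} up triples L∈ capped₃ (inside ∷ inside ∷ outside ∷ []) (inside ∷ outside ∷ outside ∷ []) tt tt

        bx≤p : p * b + q * x ≤ p
        -- The prefix paired with 0111 needs length 4, so f(110) is replaced by f(1101), the larger
        -- of the two links it averages.
        bx≤p = ≤-trans (+-monoˡ-≤ (q * x) (*-monoʳ-≤ p 0≤p b≤b₁))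
          (nested {4} {f = f} up triples L∈ capped (inside ∷ inside ∷ outside ∷ inside ∷ []) (outside ∷ inside ∷ inside ∷ inside ∷ []) tt tt)
          where
          b₁ b₀ : ℚ
          b₁ = G (prefixed {4} (inside ∷ inside ∷ outside ∷ inside ∷ []) f)
          b₀ = G (prefixed {4} (inside ∷ inside ∷ outside ∷ outside ∷ []) f)
          b≤b₁ : b ≤ b₁
          b≤b₁ = ≤-gap (0≤* 0≤q (0≤gap (measure-mono 0≤p p≤1 λ {A} → up (++-≼
              {u = inside ∷ inside ∷ outside ∷ outside ∷ []} {inside ∷ inside ∷ outside ∷ inside ∷ []} {A}
              (toWitness {a? = (inside ∷ inside ∷ outside ∷ outside ∷ []) ≼? (inside ∷ inside ∷ outside ∷ inside ∷ [])} tt)))))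
            (solve 3 (λ p b₁ b₀ → b₁ :- (p :* b₁ :+ (con 1ℚ :- p) :* b₀) := (con 1ℚ :- p) :* (b₁ :- b₀)) refl p b₁ b₀)

        x≤p : x ≤ p
        x≤p = single {4} {f = f} up triples L∈ capped (outside ∷ inside ∷ inside ∷ inside ∷ []) tt

        -- At position 4 + j the two prefixes 100 use 2 and the third member at most 2 + j of the
        -- available 8 + 2j. This leaves (1 + j) + 3 for two tails of length 1 + j, whence the
        -- exponent 3.
        d≤ : d ≤ p * ω ^ 3
        d≤ = pair-walks 0≤p p≤q 0≤ω ωq≡p (Upward-prefixed {3} {f = f} (inside ∷ outside ∷ outside ∷ []) up) 3
          λ {A} {B} A∈ B∈ h → triples A∈ B∈ L∈ λ
            { 0 → z≤n
            ; 1 → ℕ.≤-refl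
            ; 2 → ℕ.+-mono-≤ (ℕ.≤-refl {2}) (ℕ.≤-trans (count≤ L 1) (ℕ.n≤1+n 1))
            ; 3 → ℕ.+-mono-≤ (ℕ.≤-refl {2}) (ℕ.≤-trans (count≤ L 2) (ℕ.m≤m+n 2 2))
            ; (suc (suc (suc (suc j)))) → far A B j (h (suc j)) }
          where
          far : ∀ A B j → count A (suc j) ℕ.+ count B (suc j) ℕ.≤ suc j ℕ.+ 3 →
            suc (count A (suc j)) ℕ.+ suc (count B (suc j)) ℕ.+ count L (3 ℕ.+ j) ℕ.≤ (4 ℕ.+ j) ℕ.* 2
          far A B j h = begin
            suc (count A (suc j)) ℕ.+ suc (count B (suc j)) ℕ.+ count L (3 ℕ.+ j)
              ≡⟨ cong (λ s → suc s ℕ.+ count L (3 ℕ.+ j)) (ℕ.+-suc (count A (suc j)) (count B (suc j))) ⟩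
            2 ℕ.+ (count A (suc j) ℕ.+ count B (suc j)) ℕ.+ count L (3 ℕ.+ j)
              ≤⟨ ℕ.+-mono-≤ (ℕ.+-monoʳ-≤ 2 h) (ℕ.≤-trans (count-+ L 3 j) (ℕ.+-monoˡ-≤ j L≤2)) ⟩
            2 ℕ.+ (suc j ℕ.+ 3) ℕ.+ (2 ℕ.+ j)
              ≡⟨ ℕ-Solver.solve 1 (λ j → ℕ-Solver.con 2 ℕ-Solver.:+ (ℕ-Solver.con 1 ℕ-Solver.:+ j ℕ-Solver.:+ ℕ-Solver.con 3) ℕ-Solver.:+ (ℕ-Solver.con 2 ℕ-Solver.:+ j) ℕ-Solver.:= (ℕ-Solver.con 4 ℕ-Solver.:+ j) ℕ-Solver.:* ℕ-Solver.con 2) refl j ⟩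
            (4 ℕ.+ j) ℕ.* 2 ∎
            where open ℕ.≤-Reasoning

        rest : ℚ
        rest = p * (p * (q * r₁) + q * r₂) + q * r₃

        rest≤ : rest ≤ q * (p ^ 5 * (p * (+ 31 / 5) + (+ 13 / 25)))
        rest≤ with LateMember.latest {f = f} triples L∈ (late-1 L≤2)
        ... | k , lat = begin
          p * (p * (q * r₁) + q * r₂) + q * r₃
            ≤⟨ +-mono-≤ (*-monoʳ-≤ p 0≤p (+-mono-≤ (*-monoʳ-≤ p 0≤p (*-monoʳ-≤ q 0≤q r₁≤)) (*-monoʳ-≤ q 0≤q r₂≤))) (*-monoʳ-≤ q 0≤q r₃≤) ⟩
          -- The steps up in each prefix complete the factor of its bound to p⁵, so the three terms
          -- merge.
          p * (p * (q * bound 3) + q * bound 4) + q * bound 5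
            ≡⟨ solve 8 (λ p q a b c d e f →
                 p :* (p :* (q :* (p :* (p :* (p :* con 1ℚ)) :* (p :* a :+ d))) :+ q :* (p :* (p :* (p :* (p :* con 1ℚ))) :* (p :* b :+ e)))
                   :+ q :* (p :* (p :* (p :* (p :* (p :* con 1ℚ)))) :* (p :* c :+ f)) :=
                 q :* (p :* (p :* (p :* (p :* (p :* con 1ℚ)))) :* (p :* (a :+ b :+ c) :+ (d :+ e :+ f)))) refl
                 p q (before k 3) (before k 4) (before k 5) (passing k 3) (passing k 4) (passing k 5) ⟩
          q * (p ^ 5 * (p * before₃ k + passing₃ k))
            ≤⟨ *-monoʳ-≤ q 0≤q (*-monoʳ-≤ (p ^ 5) (0≤^ 5 0≤p) (few-steps ⅖≤p p≤½ k)) ⟩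
          q * (p ^ 5 * (p * (+ 31 / 5) + (+ 13 / 25))) ∎
          where
          open ≤-Reasoning
          bound : ℕ → ℚ
          bound = walkBound 0≤p p≤q p²q≤⅛ k
          parts : ∀ {A B} → A ∈ f /ᶠ outside → B ∈ f /ᶠ outside → ¬ Parts 3 (suc k) A B
          parts = LateMember.latest-parts {f = f} triples lat
          misses : ∀ {A} → A ∈ f /ᶠ outside → ¬ Misses 3 (suc k) A
          misses = proj₂ lat
          r₁≤ : r₁ ≤ bound 3
          r₁≤ = walks 0≤p p≤q p²q≤⅛ (Upward-prefixed {4} {f = f} (outside ∷ inside ∷ inside ∷ outside ∷ []) up) 3 k
            (λ A∈ B∈ w → parts A∈ B∈ (rise (rise (run w)))) (λ A∈ w → misses A∈ (rise (rise (run w))))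
          r₂≤ : r₂ ≤ bound 4
          r₂≤ = walks 0≤p p≤q p²q≤⅛ (Upward-prefixed {3} {f = f} (outside ∷ inside ∷ outside ∷ []) up) 4 k
            (λ A∈ B∈ w → parts A∈ B∈ (rise (run w))) (λ A∈ w → misses A∈ (rise (run w)))
          r₃≤ : r₃ ≤ bound 5
          r₃≤ = walks 0≤p p≤q p²q≤⅛ (Upward-prefixed {2} {f = f} (outside ∷ outside ∷ []) up) 5 k
            (λ A∈ B∈ w → parts A∈ B∈ (run w)) (λ A∈ w → misses A∈ (run w))

        -- The coefficients are those for which everything but p² and the last three error terms cancels.
        case-II : G f ≤ p * p + (p * p * p * q * ((q - p) * (+ 2 / 1) * ω ^ 3 + (p * (+ 5 / 1) - (+ 2 / 1)))
          + q * (q * (p ^ 5 * (p * (+ 31 / 5) + (+ 13 / 25)))))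
        case-II = ≤-gap
          (0≤+ (0≤+ (0≤+ (0≤+ (0≤+ (0≤+
            (0≤* 0≤p² (0≤gap ad≤p))
            (0≤* 0≤p² (0≤gap bc≤p)))
            (0≤* (0≤* (0≤* (nonNegative⁻¹ (+ 2 / 1)) 0≤p²) 0≤q-p) (0≤gap bx≤p)))
            (0≤* (0≤* 0≤p (0≤* 0≤q-p 0≤q-p)) (0≤gap bd≤p)))
            (0≤* (0≤* (0≤* 0≤p² 0≤q) 0≤5p-2) (0≤gap x≤p)))
            (0≤* (0≤* (0≤* (0≤* (nonNegative⁻¹ (+ 2 / 1)) 0≤p²) 0≤q) 0≤q-p) (0≤gap d≤)))
            (0≤* 0≤q (0≤gap rest≤)))
          (solve 11 (λ p a b c d x r₁ r₂ r₃ w R →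
            let q = con 1ℚ :- p ; 2# = con (+ 2 / 1) ; 5p-2 = p :* con (+ 5 / 1) :- con (+ 2 / 1) in
            (p :* p :+ (p :* p :* p :* q :* ((q :- p) :* 2# :* w :+ 5p-2) :+ q :* R))
              :- (p :* (p :* (p :* a :+ q :* b) :+ q :* (p :* c :+ q :* d))
                  :+ q :* (p :* (p :* (p :* x :+ q :* r₁) :+ q :* r₂) :+ q :* r₃)) :=
            p :* p :* (p :- (p :* a :+ q :* d))
              :+ p :* p :* (p :- (p :* b :+ q :* c))
              :+ 2# :* (p :* p) :* (q :- p) :* (p :- (p :* b :+ q :* x))
              :+ p :* ((q :- p) :* (q :- p)) :* (p :- (p :* b :+ q :* d))
              :+ p :* p :* q :* 5p-2 :* (p :- x)
              :+ 2# :* (p :* p) :* q :* (q :- p) :* (p :* w :- d)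
              :+ q :* (R :- (p :* (p :* (q :* r₁) :+ q :* r₂) :+ q :* r₃)))
            refl p a b c d x r₁ r₂ r₃ (ω ^ 3) (q * (p ^ 5 * (p * (+ 31 / 5) + (+ 13 / 25)))))
          where
          0≤p² : 0ℚ ≤ p * p
          0≤p² = 0≤* 0≤p 0≤p
          0≤q-p : 0ℚ ≤ q - p
          0≤q-p = 0≤gap p≤q
          -- The lower end 2/5 of the range makes this multiplier of p - x nonnegative.
          0≤5p-2 : 0ℚ ≤ p * (+ 5 / 1) - (+ 2 / 1)
          0≤5p-2 = subst (0ℚ ≤_) (solve 1 (λ p → con (+ 5 / 1) :* (p :- con ⅖) := p :* con (+ 5 / 1) :- con (+ 2 / 1)) refl p)
            (0≤* (nonNegative⁻¹ (+ 5 / 1)) (0≤gap ⅖≤p))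

  -- Certified polynomial inequalities on an interval

  infixl 6 _⊕_ _⊖_
  infixl 7 _⊗_

  -- Polynomials as syntax, so that they can be expanded around the left end of an interval.
  data Expr : Set where
    const   : ℚ → Expr
    var     : Expr
    _⊕_ _⊖_ _⊗_ : Expr → Expr → Expr

  value : Expr → ℚ → ℚ
  value (const c) x = c
  value var       x = x
  value (e ⊕ e′)  x = value e x + value e′ x
  value (e ⊖ e′)  x = value e x - value e′ x
  value (e ⊗ e′)  x = value e x * value e′ x

  evaluate : List ℚ → ℚ → ℚ
  evaluate []       x = 0ℚ
  evaluate (c ∷ cs) x = c + x * evaluate cs x

  scale : ℚ → List ℚ → List ℚ
  scale c []       = []
  scale c (d ∷ ds) = c * d ∷ scale c ds

  add multiply : List ℚ → List ℚ → List ℚ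
  add []       ds       = ds
  add (c ∷ cs) []       = c ∷ cs
  add (c ∷ cs) (d ∷ ds) = c + d ∷ add cs ds
  multiply []       ds = []
  multiply (c ∷ cs) ds = add (scale c ds) (0ℚ ∷ multiply cs ds)

  evaluate-scale : ∀ c ds x → evaluate (scale c ds) x ≡ c * evaluate ds x
  evaluate-scale c []       x = sym (*-zeroʳ c)
  evaluate-scale c (d ∷ ds) x rewrite evaluate-scale c ds x =
    solve 4 (λ c d x e → c :* d :+ x :* (c :* e) := c :* (d :+ x :* e)) refl c d x (evaluate ds x)

  evaluate-add : ∀ cs ds x → evaluate (add cs ds) x ≡ evaluate cs x + evaluate ds x
  evaluate-add []       ds       x = sym (+-identityˡ _)
  evaluate-add (c ∷ cs) []       x = sym (+-identityʳ _)
  evaluate-add (c ∷ cs) (d ∷ ds) x rewrite evaluate-add cs ds x =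
    solve 5 (λ c d x e f → c :+ d :+ x :* (e :+ f) := (c :+ x :* e) :+ (d :+ x :* f)) refl
      c d x (evaluate cs x) (evaluate ds x)

  evaluate-multiply : ∀ cs ds x → evaluate (multiply cs ds) x ≡ evaluate cs x * evaluate ds x
  evaluate-multiply []       ds x = sym (*-zeroˡ (evaluate ds x))
  evaluate-multiply (c ∷ cs) ds x
    rewrite evaluate-add (scale c ds) (0ℚ ∷ multiply cs ds) x | evaluate-scale c ds x | evaluate-multiply cs ds x =
    solve 4 (λ c x e f → c :* f :+ (con 0ℚ :+ x :* (e :* f)) := (c :+ x :* e) :* f) refl c x (evaluate cs x) (evaluate ds x)

  -- The coefficients in powers of x - a.
  coefficients : Expr → ℚ → List ℚ
  coefficients (const c) a = c ∷ []
  coefficients var       a = a ∷ 1ℚ ∷ []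
  coefficients (e ⊕ e′)  a = add (coefficients e a) (coefficients e′ a)
  coefficients (e ⊖ e′)  a = add (coefficients e a) (scale (- 1ℚ) (coefficients e′ a))
  coefficients (e ⊗ e′)  a = multiply (coefficients e a) (coefficients e′ a)

  coefficients-sound : ∀ e a x → evaluate (coefficients e a) (x - a) ≡ value e x
  coefficients-sound (const c) a x = solve 2 (λ c y → c :+ y :* con 0ℚ := c) refl c (x - a)
  coefficients-sound var a x =
    solve 2 (λ a x → a :+ (x :- a) :* (con 1ℚ :+ (x :- a) :* con 0ℚ) := x) refl a x
  coefficients-sound (e ⊕ e′) a x
    rewrite evaluate-add (coefficients e a) (coefficients e′ a) (x - a) =
    cong₂ _+_ (coefficients-sound e a x) (coefficients-sound e′ a x)
  coefficients-sound (e ⊖ e′) a x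
    rewrite evaluate-add (coefficients e a) (scale (- 1ℚ) (coefficients e′ a)) (x - a)
          | evaluate-scale (- 1ℚ) (coefficients e′ a) (x - a) =
    trans (cong₂ (λ s t → s + (- 1ℚ) * t) (coefficients-sound e a x) (coefficients-sound e′ a x))
      (solve 2 (λ s t → s :+ con (- 1ℚ) :* t := s :- t) refl (value e x) (value e′ x))
  coefficients-sound (e ⊗ e′) a x
    rewrite evaluate-multiply (coefficients e a) (coefficients e′ a) (x - a) =
    cong₂ _*_ (coefficients-sound e a x) (coefficients-sound e′ a x)

  -- A lower bound on [0, w] by interval arithmetic on Horner's scheme.
  lower : ℚ → List ℚ → ℚ
  lower w []       = 0ℚ
  lower w (c ∷ cs) = c + (w * lower w cs ⊓ 0ℚ)

  lower-sound : ∀ {w x} cs → 0ℚ ≤ x → x ≤ w → lower w cs ≤ evaluate cs x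
  lower-sound []       0≤x x≤w = ≤-refl
  lower-sound {w} {x} (c ∷ cs) 0≤x x≤w = +-monoʳ-≤ c (≤-trans bound (*-monoʳ-≤ x 0≤x (lower-sound cs 0≤x x≤w)))
    where
    l = lower w cs
    bound : w * l ⊓ 0ℚ ≤ x * l
    bound with ≤-total 0ℚ l
    ... | inj₁ 0≤l = ≤-trans (p⊓q≤q (w * l) 0ℚ) (0≤* 0≤x 0≤l)
    ... | inj₂ l≤0 = ≤-trans (p⊓q≤p (w * l) 0ℚ) (*-monoʳ-≤-nonPos l {{nonPositive l≤0}} x≤w)

  positive-on : ∀ e a b → True (0ℚ ≤? lower (b - a) (coefficients e a)) → ∀ {x} → a ≤ x → x ≤ b → 0ℚ ≤ value e x
  positive-on e a b h {x} a≤x x≤b = ≤-trans (toWitness h)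
    (subst (lower (b - a) (coefficients e a) ≤_) (coefficients-sound e a x)
      (lower-sound (coefficients e a) (0≤gap a≤x) (+-monoˡ-≤ (- a) x≤b)))

  private
    p̂ q̂ BD̂ target : Expr
    p̂ = var
    q̂ = const 1ℚ ⊖ var
    BD̂ = const (+ 4 / 1) ⊗ (p̂ ⊗ p̂ ⊗ p̂ ⊗ q̂) ⊕ p̂ ⊗ p̂ ⊗ p̂ ⊗ p̂
    target = BD̂ ⊖ const (+ 91 / 50000)

    power : Expr → ℕ → Expr
    power e zero    = const 1ℚ
    power e (suc k) = e ⊗ power e k

    -- polyII is q² times the slack in case II, where ω is eliminated by ω q = p.
    polyI polyII : Expr
    polyI  = target ⊖ (p̂ ⊗ p̂ ⊕ q̂ ⊗ (p̂ ⊗ (p̂ ⊗ (p̂ ⊗ p̂))))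
    polyII = q̂ ⊗ q̂ ⊗ (target ⊖ (p̂ ⊗ p̂ ⊕ (p̂ ⊗ p̂ ⊗ p̂ ⊗ q̂ ⊗ (p̂ ⊗ const (+ 5 / 1) ⊖ const (+ 2 / 1))
      ⊕ q̂ ⊗ (q̂ ⊗ (power p̂ 5 ⊗ (p̂ ⊗ const (+ 31 / 5) ⊕ const (+ 13 / 25)))))))
      ⊖ const (+ 2 / 1) ⊗ (q̂ ⊖ p̂) ⊗ power p̂ 6

  BDmeasure : ℚ → ℚ
  BDmeasure = value BD̂

  -- 0.0018, plus 0.00002 for the passage to real p.
  margin : ℚ
  margin = + 91 / 50000

  module _ {p : ℚ} (⅖≤p : ⅖ ≤ p) (p≤½ : p ≤ ½) where

    -- The slack of case II drops below 0.0002 near p = 19/40. The interval bound is sharper on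
    -- short intervals, which is why the cuts cluster there.
    polyII-positive : 0ℚ ≤ value polyII p
    polyII-positive =
      [ positive-on polyII ⅖ (+ 9 / 20) tt ⅖≤p
      , (λ l → [ positive-on polyII (+ 9 / 20) (+ 93 / 200) tt l
               , (λ l → [ positive-on polyII (+ 93 / 200) (+ 19 / 40) tt l
                        , (λ l → positive-on polyII (+ 19 / 40) ½ tt l p≤½)
                        ]′ (≤-total p (+ 19 / 40)))
               ]′ (≤-total p (+ 93 / 200)))
      ]′ (≤-total p (+ 9 / 20))

    bound-I : p * p + (1ℚ - p) * (p * (p * (p * p))) ≤ BDmeasure p - margin
    bound-I = ≤-gap (positive-on polyI ⅖ ½ tt ⅖≤p p≤½) refl

    private
      q : ℚ
      q = 1ℚ - p
      0≤p : 0ℚ ≤ p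
      0≤p = ≤-trans (nonNegative⁻¹ ⅖) ⅖≤p
      ½≤q : ½ ≤ q
      ½≤q = +-monoʳ-≤ 1ℚ (neg-antimono-≤ p≤½)
      instance
        q-pos : Positive q
        q-pos = positive (<-≤-trans (positive⁻¹ ½) ½≤q)
        q-nonZero : NonZero q
        q-nonZero = pos⇒nonZero q
      ω : ℚ
      ω = p * 1/ q
      0≤ω : 0ℚ ≤ ω
      0≤ω = 0≤* 0≤p (<⇒≤ (positive⁻¹ (1/ q) {{1/pos⇒pos q}}))
      ωq≡p : ω * q ≡ p
      ωq≡p = trans (*-assoc p (1/ q) q) (trans (cong (p *_) (*-inverseˡ q)) (*-identityʳ p))

    bound-II : p * p + (p * p * p * q * ((q - p) * (+ 2 / 1) * ω ^ 3 + (p * (+ 5 / 1) - (+ 2 / 1)))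
      + q * (q * (p ^ 5 * (p * (+ 31 / 5) + (+ 13 / 25))))) ≤ BDmeasure p - margin
    bound-II = ≤-gap (*-cancelˡ-≤-pos (q * q) {{pos*pos⇒pos q q}} (begin
        q * q * 0ℚ           ≡⟨ *-zeroʳ (q * q) ⟩
        0ℚ                   ≤⟨ polyII-positive ⟩
        value polyII p       ≡⟨ solve 3 (λ p w ω →
            let q = con 1ℚ :- p
                2# = con (+ 2 / 1)
                5p-2 = p :* con (+ 5 / 1) :- 2#
                target = con (+ 4 / 1) :* (p :* p :* p :* q) :+ p :* p :* p :* p :- con margin
                R = q :* (p :* (p :* (p :* (p :* (p :* con 1ℚ)))) :* (p :* con (+ 31 / 5) :+ con (+ 13 / 25)))
            in
            q :* q :* (target :- (p :* p :+ (p :* p :* p :* q :* 5p-2 :+ q :* R)))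
              :- 2# :* (q :- p) :* (p :* (p :* (p :* (p :* (p :* (p :* con 1ℚ)))))) :=
            q :* q :* (target :- (p :* p :+ (p :* p :* p :* q :* ((q :- p) :* 2# :* (ω :* (ω :* (ω :* con 1ℚ))) :+ 5p-2) :+ q :* R)))
              :- 2# :* (q :- p) :* (p :* p :* p) :* (p :* p :* p :- (ω :* q) :* (ω :* q) :* (ω :* q))) refl p p ω ⟩
        q * q * D - (+ 2 / 1) * (q - p) * (p * p * p) * (p * p * p - (ω * q) * (ω * q) * (ω * q))
          ≡⟨ cong (λ x → q * q * D - (+ 2 / 1) * (q - p) * (p * p * p) * (p * p * p - x * x * x)) ωq≡p ⟩
        q * q * D - (+ 2 / 1) * (q - p) * (p * p * p) * (p * p * p - p * p * p)
          ≡⟨ solve 3 (λ a b c → a :- b :* (c :- c) := a) refl (q * q * D) ((+ 2 / 1) * (q - p) * (p * p * p)) (p * p * p) ⟩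
        q * q * D ∎)) refl
      where
      open ≤-Reasoning
      D : ℚ
      D = BDmeasure p - margin - (p * p + (p * p * p * q * ((q - p) * (+ 2 / 1) * ω ^ 3 + (p * (+ 5 / 1) - (+ 2 / 1)))
        + q * (q * (p ^ 5 * (p * (+ 31 / 5) + (+ 13 / 25))))))

    measure-bound : ∀ {m} {f : Subset (4 ℕ.+ m) → Bool} → Upward f → Triples f →
      ∀ {L} → L ∈ f /ᶠ outside → ∀ {F} → F ∈ f → count F 4 ℕ.≤ 2 → measure p f ≤ BDmeasure p - margin
    measure-bound {m} {f} up triples L∈ F∈ F≤2 =
      decide (Subset.anySubset? (λ A → T? (f (outside ∷ A)) ×-dec count A 3 ℕ.≤? 2))
      where
      decide : Dec (∃ λ A → A ∈ f /ᶠ outside × count A 3 ℕ.≤ 2) → measure p f ≤ BDmeasure p - margin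
      decide (yes (A , A∈ , A≤2)) = ≤-trans (CaseII.case-II ⅖≤p p≤½ {f = f} up triples A∈ A≤2 0≤ω ωq≡p) bound-II
      decide (no none) = ≤-trans (case-I ⅖≤p p≤½ {f = f} up triples L∈ F∈ F≤2 λ A∈ A≤2 → none (_ , A∈ , A≤2)) bound-I

  -- From the defining sum to the recursive measure

  total : ∀ {A : Set} → (A → Bool) → (A → ℚ) → List A → ℚ
  total f w []       = 0ℚ
  total f w (x ∷ xs) = (if f x then w x else 0ℚ) + total f w xs

  total-++ : ∀ {A : Set} (f : A → Bool) w xs ys → total f w (xs ++ ys) ≡ total f w xs + total f w ys
  total-++ f w []       ys = sym (+-identityˡ _)
  total-++ f w (x ∷ xs) ys = trans (cong (λ s → (if f x then w x else 0ℚ) + s) (total-++ f w xs ys)) (sym (+-assoc (if f x then w x else 0ℚ) _ _))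

  total-map : ∀ {A B : Set} (f : B → Bool) w (g : A → B) xs →
    total f w (map g xs) ≡ total (λ x → f (g x)) (λ x → w (g x)) xs
  total-map f w g []       = refl
  total-map f w g (x ∷ xs) = cong (λ s → (if f (g x) then w (g x) else 0ℚ) + s) (total-map f w g xs)

  total-scale : ∀ {A : Set} (f : A → Bool) {v w : A → ℚ} c → (∀ x → w x ≡ c * v x) → ∀ xs →
    total f w xs ≡ c * total f v xs
  total-scale f c eq [] = sym (*-zeroʳ c)
  total-scale f {v} {w} c eq (x ∷ xs) = trans (cong₂ _+_ (choose (f x)) (total-scale f c eq xs)) (sym (*-distribˡ-+ c _ _))
    where
    choose : ∀ b → (if b then w x else 0ℚ) ≡ c * (if b then v x else 0ℚ)
    choose true  = eq x
    choose false = sym (*-zeroʳ c)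

  term : ∀ {n} → ℚ → Subset n → ℚ
  term {n} r G = r ^ ∣ G ∣ * (1ℚ - r) ^ (n ∸ ∣ G ∣)

  total-measure : ∀ n r (f : Subset n → Bool) → total f (term r) (allSubsets n) ≡ measure r f
  total-measure zero r f = trans (+-identityʳ _) (choose (f []))
    where
    choose : ∀ b → (if b then 1ℚ * 1ℚ else 0ℚ) ≡ (if b then 1ℚ else 0ℚ)
    choose true  = refl
    choose false = refl
  total-measure (suc n) r f = begin
    total f (term r) (map (inside ∷_) (allSubsets n) ++ map (outside ∷_) (allSubsets n))
      ≡⟨ total-++ f (term r) (map (inside ∷_) (allSubsets n)) _ ⟩
    total f (term r) (map (inside ∷_) (allSubsets n)) + total f (term r) (map (outside ∷_) (allSubsets n))
      ≡⟨ cong₂ _+_ (part inside r (λ G → *-assoc r (r ^ ∣ G ∣) _)) (part outside (1ℚ - r) out) ⟩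
    r * measure r (f /ᶠ inside) + (1ℚ - r) * measure r (f /ᶠ outside) ∎
    where
    open ≡-Reasoning
    part : ∀ x c → (∀ G → term r (x ∷ G) ≡ c * term r G) →
      total f (term r) (map (x ∷_) (allSubsets n)) ≡ c * measure r (f /ᶠ x)
    part x c eq = begin
      total f (term r) (map (x ∷_) (allSubsets n))  ≡⟨ total-map f (term r) (x ∷_) (allSubsets n) ⟩
      total (f /ᶠ x) (λ G → term r (x ∷ G)) (allSubsets n)
        ≡⟨ total-scale (f /ᶠ x) {term r} {λ G → term r (x ∷ G)} c eq (allSubsets n) ⟩
      c * total (f /ᶠ x) (term r) (allSubsets n)    ≡⟨ cong (c *_) (total-measure n r (f /ᶠ x)) ⟩
      c * measure r (f /ᶠ x)                        ∎
    out : ∀ G → term r (outside ∷ G) ≡ (1ℚ - r) * term r G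
    out G = begin
      r ^ ∣ G ∣ * (1ℚ - r) ^ (suc n ∸ ∣ G ∣)
        ≡⟨ cong (λ k → r ^ ∣ G ∣ * (1ℚ - r) ^ k) (ℕ.+-∸-assoc 1 (Subset.∣p∣≤n G)) ⟩
      r ^ ∣ G ∣ * ((1ℚ - r) * (1ℚ - r) ^ (n ∸ ∣ G ∣))
        ≡⟨ solve 3 (λ a b c → a :* (b :* c) := b :* (a :* c)) refl (r ^ ∣ G ∣) (1ℚ - r) ((1ℚ - r) ^ (n ∸ ∣ G ∣)) ⟩
      (1ℚ - r) * (r ^ ∣ G ∣ * (1ℚ - r) ^ (n ∸ ∣ G ∣)) ∎

  seq-^ : ∀ x k i → seq (x ℝ.^ k) i ≡ seq x i ^ k
  seq-^ x zero    i = refl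
  seq-^ x (suc k) i = cong (seq x i *_) (seq-^ x k i)

  -- Real arithmetic acts termwise on sequences, so every term of the sequence of `μ p 𝓕?` is the
  -- measure at a rational approximant of p.
  seq-μ : ∀ {n} p {𝓕 : Family n} (𝓕? : Decidable 𝓕) i → seq (μ p 𝓕?) i ≡ measure (seq p i) (λ G → isYes (𝓕? G))
  seq-μ {n} p 𝓕? i = trans (sums (allSubsets n)) (total-measure n (seq p i) _)
    where
    termℝ : Subset n → ℝ
    termℝ G = p ℝ.^ ∣ G ∣ ℝ.* (ℝ.1ℝ ℝ.- p) ℝ.^ (n ∸ ∣ G ∣)
    sums : ∀ xs → seq (ℝ.sum (map termℝ (filter 𝓕? xs))) i ≡ total (λ G → isYes (𝓕? G)) (term (seq p i)) xs
    sums []       = refl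
    sums (G ∷ xs) with 𝓕? G
    ... | yes _ = cong₂ _+_ (cong₂ _*_ (seq-^ p ∣ G ∣ i) (seq-^ (ℝ.1ℝ ℝ.- p) (n ∸ ∣ G ∣) i)) (sums xs)
    ... | no  _ = trans (sums xs) (sym (+-identityˡ _))

  ∣∩initial∣ : ∀ {m} (F : Subset (4 ℕ.+ m)) → ∣ F ∩ initial 4 ∣ ≡ count F 4
  ∣∩initial∣ (a ∷ b ∷ c ∷ d ∷ A) = head a (head b (head c (head d (none A))))
    where
    none : ∀ {n} (A : Subset n) → ∣ A ∩ tabulate (λ _ → outside) ∣ ≡ 0
    none []            = refl
    none (inside  ∷ A) = none A
    none (outside ∷ A) = none A
    head : ∀ {n} x {A B : Subset n} {k} → ∣ A ∩ B ∣ ≡ count A k →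
      ∣ (x ∷ A) ∩ (inside ∷ B) ∣ ≡ count (x ∷ A) (suc k)
    head inside  eq = cong suc eq
    head outside eq = eq

  BDᵇ : ∀ {m} → Subset (4 ℕ.+ m) → Bool
  BDᵇ {m} F = isYes (BD₃? (4 ℕ.+ m) F)

  ∈BDᵇ : ∀ {m} {F : Subset (4 ℕ.+ m)} → 3 ℕ.≤ count F 4 → F ∈ BDᵇ
  ∈BDᵇ {m} {F} h = fromWitness {a? = BD₃? (4 ℕ.+ m) F} (subst (3 ℕ.≤_) (sym (∣∩initial∣ F)) h)

  BDᵇ-upward : ∀ {m} → Upward (BDᵇ {m})
  BDᵇ-upward {m} {A} {B} A≼B A∈ = ∈BDᵇ {F = B} (ℕ.≤-trans
    (subst (3 ℕ.≤_) (∣∩initial∣ A) (toWitness {a? = BD₃? (4 ℕ.+ m) A} A∈)) (A≼B 4))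

  -- The links at 111, 1101, 1011 and 0111 are full and give p³ + 3p³q, which is 4p³q + p⁴; the
  -- other six contribute nonnegatively.
  BDmeasure≤ : ∀ {m p} → 0ℚ ≤ p → p ≤ 1ℚ → BDmeasure p ≤ measure p (BDᵇ {m})
  BDmeasure≤ {m} {p} 0≤p p≤1 = ≤-gap
    (0≤+ (0≤+ (0≤+ (0≤+ (0≤+ (0≤+ (0≤+ (0≤+ (0≤+
      (0≤* 0≤p³ (0≤gap (full (f /ᶠ inside /ᶠ inside /ᶠ inside) λ A → ∈BDᵇ {F = inside ∷ inside ∷ inside ∷ A} (ℕ.m≤m+n 3 _))))
      (0≤* 0≤p³q (0≤gap (full (f /ᶠ inside /ᶠ inside /ᶠ outside /ᶠ inside) λ A → ∈BDᵇ {F = inside ∷ inside ∷ outside ∷ inside ∷ A} ℕ.≤-refl))))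
      (0≤* 0≤p³q (0≤gap (full (f /ᶠ inside /ᶠ outside /ᶠ inside /ᶠ inside) λ A → ∈BDᵇ {F = inside ∷ outside ∷ inside ∷ inside ∷ A} ℕ.≤-refl))))
      (0≤* 0≤p³q (0≤gap (full (f /ᶠ outside /ᶠ inside /ᶠ inside /ᶠ inside) λ A → ∈BDᵇ {F = outside ∷ inside ∷ inside ∷ inside ∷ A} ℕ.≤-refl))))
      (0≤* 0≤p²q² (0≤measure 0≤p p≤1 (f /ᶠ inside /ᶠ inside /ᶠ outside /ᶠ outside))))
      (0≤* 0≤p²q² (0≤measure 0≤p p≤1 (f /ᶠ inside /ᶠ outside /ᶠ inside /ᶠ outside))))
      (0≤* 0≤p²q² (0≤measure 0≤p p≤1 (f /ᶠ outside /ᶠ inside /ᶠ inside /ᶠ outside))))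
      (0≤* 0≤pq² (0≤measure 0≤p p≤1 (f /ᶠ inside /ᶠ outside /ᶠ outside))))
      (0≤* 0≤pq² (0≤measure 0≤p p≤1 (f /ᶠ outside /ᶠ inside /ᶠ outside))))
      (0≤* 0≤q² (0≤measure 0≤p p≤1 (f /ᶠ outside /ᶠ outside))))
    (solve 11 (λ p a b c d e f g h i j → let q = con 1ℚ :- p in
        (p :* (p :* (p :* a :+ q :* (p :* b :+ q :* e)) :+ q :* (p :* (p :* c :+ q :* f) :+ q :* h))
          :+ q :* (p :* (p :* (p :* d :+ q :* g) :+ q :* i) :+ q :* j))
          :- (con 4# :* (p :* p :* p :* q) :+ p :* p :* p :* p) :=
        p :* p :* p :* (a :- con 1ℚ) :+ p :* p :* p :* q :* (b :- con 1ℚ) :+ p :* p :* p :* q :* (c :- con 1ℚ)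
          :+ p :* p :* p :* q :* (d :- con 1ℚ) :+ p :* p :* q :* q :* e :+ p :* p :* q :* q :* f
          :+ p :* p :* q :* q :* g :+ p :* q :* q :* h :+ p :* q :* q :* i :+ q :* q :* j) refl p
      (measure p (f /ᶠ inside /ᶠ inside /ᶠ inside)) (measure p (f /ᶠ inside /ᶠ inside /ᶠ outside /ᶠ inside))
      (measure p (f /ᶠ inside /ᶠ outside /ᶠ inside /ᶠ inside)) (measure p (f /ᶠ outside /ᶠ inside /ᶠ inside /ᶠ inside))
      (measure p (f /ᶠ inside /ᶠ inside /ᶠ outside /ᶠ outside)) (measure p (f /ᶠ inside /ᶠ outside /ᶠ inside /ᶠ outside))
      (measure p (f /ᶠ outside /ᶠ inside /ᶠ inside /ᶠ outside)) (measure p (f /ᶠ inside /ᶠ outside /ᶠ outside))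
      (measure p (f /ᶠ outside /ᶠ inside /ᶠ outside)) (measure p (f /ᶠ outside /ᶠ outside)))
    where
    f : Subset (4 ℕ.+ m) → Bool
    f = BDᵇ
    4# q : ℚ
    4# = + 4 / 1
    q = 1ℚ - p
    full : ∀ {n} (g : Subset n → Bool) → (∀ A → A ∈ g) → 1ℚ ≤ measure p g
    full g h = ≤-reflexive (sym (measure-full p {g} h))
    0≤q : 0ℚ ≤ q
    0≤q = 0≤gap p≤1
    0≤q² : 0ℚ ≤ q * q
    0≤q² = 0≤* 0≤q 0≤q
    0≤pq² : 0ℚ ≤ p * q * q
    0≤pq² = 0≤* (0≤* 0≤p 0≤q) 0≤q
    0≤p²q² : 0ℚ ≤ p * p * q * q
    0≤p²q² = 0≤* (0≤* (0≤* 0≤p 0≤p) 0≤q) 0≤q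
    0≤p³ : 0ℚ ≤ p * p * p
    0≤p³ = 0≤* (0≤* 0≤p 0≤p) 0≤p
    0≤p³q : 0ℚ ≤ p * p * p * q
    0≤p³q = 0≤* 0≤p³ 0≤q

  -- Passage to real p

  -- For an upward closed family the derivative in p lies between 0 and n: each coordinate
  -- contributes the difference of two nested links. This gives a one-sided estimate from x ≤ y + δ
  -- alone.
  measure-lipschitz : ∀ {n} {f : Subset n → Bool} → Upward f → ∀ {x y δ} → 0ℚ ≤ x → x ≤ 1ℚ → 0ℚ ≤ y → y ≤ 1ℚ →
    0ℚ ≤ δ → x ≤ y + δ → measure x f ≤ measure y f + ⟦ n ⟧ * δ
  measure-lipschitz {zero} {f} up {δ = δ} 0≤x x≤1 0≤y y≤1 0≤δ x≤y+δ =
    ≤-reflexive (solve 2 (λ m δ → m := m :+ con 0ℚ :* δ) refl (if f [] then 1ℚ else 0ℚ) δ)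
  measure-lipschitz {suc n} {f} up {x} {y} {δ} 0≤x x≤1 0≤y y≤1 0≤δ x≤y+δ = ≤-gap
    (0≤+ (0≤+ (0≤+ (0≤* 0≤x (0≤gap (ih inside))) (0≤* (0≤gap x≤1) (0≤gap (ih outside))))
      (0≤* (0≤gap x≤y+δ) (0≤gap links)))
      (0≤* 0≤δ (0≤+ (0≤gap (measure≤1 0≤y y≤1 (f /ᶠ inside))) (0≤measure 0≤y y≤1 (f /ᶠ outside)))))
    (begin
      measure y f + ⟦ suc n ⟧ * δ - measure x f
        ≡⟨ cong (λ k → measure y f + k * δ - measure x f) (⟦⟧-+ 1 n) ⟩
      measure y f + (1ℚ + ⟦ n ⟧) * δ - measure x f
        ≡⟨ solve 8 (λ x y δ n x₁ x₀ y₁ y₀ →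
             (y :* y₁ :+ (con 1ℚ :- y) :* y₀) :+ (con 1ℚ :+ n) :* δ :- (x :* x₁ :+ (con 1ℚ :- x) :* x₀) :=
             x :* (y₁ :+ n :* δ :- x₁) :+ (con 1ℚ :- x) :* (y₀ :+ n :* δ :- x₀)
               :+ (y :+ δ :- x) :* (y₁ :- y₀) :+ δ :* ((con 1ℚ :- y₁) :+ y₀)) refl
             x y δ ⟦ n ⟧ (measure x (f /ᶠ inside)) (measure x (f /ᶠ outside)) (measure y (f /ᶠ inside)) (measure y (f /ᶠ outside)) ⟩
      _ ∎)
    where
    open ≡-Reasoning
    ih : ∀ b → measure x (f /ᶠ b) ≤ measure y (f /ᶠ b) + ⟦ n ⟧ * δ
    ih b = measure-lipschitz (Upward-/ {f = f} b up) 0≤x x≤1 0≤y y≤1 0≤δ x≤y+δ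
    links : measure y (f /ᶠ outside) ≤ measure y (f /ᶠ inside)
    links = measure-mono 0≤y y≤1 λ {A} → up (outside≼inside A)

  -- An approximant of p may leave [2/5, 1/2] by δ, where `measure-bound` says nothing; a nearby
  -- point of the interval replaces it.
  clamp : ∀ {x δ} → 0ℚ ≤ δ → ⅖ ≤ x + δ → x ≤ ½ + δ → ∃ λ r → ⅖ ≤ r × r ≤ ½ × x ≤ r + δ × r ≤ x + δ
  clamp {x} {δ} 0≤δ l u = [ low , (λ ⅖≤x → [ high , mid ⅖≤x ]′ (≤-total ½ x)) ]′ (≤-total x ⅖)
    where
    r≤r+δ : ∀ {x y} → x ≤ y → x ≤ y + δ
    r≤r+δ {x} {y} x≤y = ≤-trans x≤y (subst (_≤ y + δ) (+-identityʳ y) (+-monoʳ-≤ y 0≤δ))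
    Goal : Set
    Goal = ∃ λ r → ⅖ ≤ r × r ≤ ½ × x ≤ r + δ × r ≤ x + δ
    low : x ≤ ⅖ → Goal
    low h = ⅖ , ≤-refl , toWitness {a? = ⅖ ≤? ½} tt , r≤r+δ h , l
    high : ½ ≤ x → Goal
    high h = ½ , toWitness {a? = ⅖ ≤? ½} tt , ≤-refl , u , r≤r+δ h
    mid : ⅖ ≤ x → x ≤ ½ → Goal
    mid h h′ = x , h , h′ , r≤r+δ ≤-refl , r≤r+δ ≤-refl

  module _ {n} (𝓕 : Family n) (𝓕? : Decidable 𝓕) where

    -- Decidable membership over finitely many subsets turns the negated inclusion into a witness.
    outlier : 𝓕 ⊈ BD₃ n → ∃ λ F → 𝓕 F × ¬ BD₃ n F
    outlier 𝓕⊈BD with Subset.anySubset? (λ F → 𝓕? F ×-dec ¬? (BD₃? n F))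
    ... | yes found = found
    ... | no  none  = ⊥-elim (𝓕⊈BD λ {F} F∈ → decidable-stable (BD₃? n F) λ F∉ → none (F , F∈ , F∉))

  avoiding-1 : ∀ {n} (𝓕 : Family (suc n)) → Decidable 𝓕 → NonTrivial 𝓕 → ∃ λ L → 𝓕 (outside ∷ L)
  avoiding-1 𝓕 𝓕? nontrivial with Subset.anySubset? (λ L → 𝓕? (outside ∷ L))
  ... | yes found = found
  ... | no  none  = ⊥-elim (nontrivial zero all)
    where
    all : ∀ G → 𝓕 G → zero Subset.∈ G
    all (inside  ∷ G) G∈ = here
    all (outside ∷ G) G∈ = ⊥-elim (none (G , G∈))

  -- A walk of length at most 2 cannot climb to y = 2x + 3, so `late-bounded` applies with k = n +
  -- 1.
  short : ∀ {n} {f : Subset (suc n) → Bool} → Triples f → n ℕ.≤ 2 → ∀ {L} → ¬ L ∈ f /ᶠ outside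
  short {n} {f} triples n≤2 {L} L∈ = ℕ.<-irrefl refl (LateMember.late-bounded {f = f} triples {suc n} L∈ λ i → inj₁ (bound i))
    where
    bound : ∀ i → count L i ℕ.* 3 ℕ.≤ i ℕ.* 2 ℕ.+ 2
    bound i = begin
      count L i ℕ.* 3                   ≡⟨ ℕ.*-suc (count L i) 2 ⟩
      count L i ℕ.+ count L i ℕ.* 2     ≡⟨ ℕ.+-comm (count L i) _ ⟩
      count L i ℕ.* 2 ℕ.+ count L i     ≤⟨ ℕ.+-mono-≤ (ℕ.*-monoˡ-≤ 2 (count≤ L i)) small ⟩
      i ℕ.* 2 ℕ.+ 2                     ∎
      where
      open ℕ.≤-Reasoning
      small : count L i ℕ.≤ 2
      small = ℕ.≤-trans (ℕ.≤-reflexive (sym (count-⊓ L i))) (ℕ.≤-trans (count≤ L _) (ℕ.≤-trans (ℕ.m⊓n≤n i n) n≤2))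

  -- The error n δ is paid twice, for moving f from x to r and `BD₃` from r back to x.
  gap-near : ∀ {m} {f g : Subset (4 ℕ.+ m) → Bool} → Upward f → Triples f → g ⊆ᶠ f →
    ∀ {L} → L ∈ f /ᶠ outside → ∀ {F} → F ∈ f → count F 4 ℕ.≤ 2 →
    ∀ {x δ} → 0ℚ ≤ x → x ≤ 1ℚ → 0ℚ ≤ δ → ⅖ ≤ x + δ → x ≤ ½ + δ →
    measure x g + (margin - (⟦ 4 ℕ.+ m ⟧ * δ + ⟦ 4 ℕ.+ m ⟧ * δ)) ≤ measure x (BDᵇ {m})
  gap-near {m} {f} {g} up triples g⊆f L∈ F∈ F≤2 {x} {δ} 0≤x x≤1 0≤δ l u = near (clamp 0≤δ l u)
    where
    open ≤-Reasoning
    e : ℚ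
    e = ⟦ 4 ℕ.+ m ⟧ * δ
    near : (∃ λ r → ⅖ ≤ r × r ≤ ½ × x ≤ r + δ × r ≤ x + δ) → measure x g + (margin - (e + e)) ≤ measure x (BDᵇ {m})
    near (r , ⅖≤r , r≤½ , x≤r+δ , r≤x+δ) = begin
      measure x g + (margin - (e + e))
        ≤⟨ +-monoˡ-≤ (margin - (e + e)) (measure-mono 0≤x x≤1 {f = g} {f} (λ {A} → g⊆f {A})) ⟩
      measure x f + (margin - (e + e))
        ≤⟨ +-monoˡ-≤ (margin - (e + e)) (measure-lipschitz {f = f} up 0≤x x≤1 0≤r r≤1 0≤δ x≤r+δ) ⟩
      measure r f + e + (margin - (e + e))
        ≤⟨ +-monoˡ-≤ (margin - (e + e)) (+-monoˡ-≤ e (measure-bound ⅖≤r r≤½ {f = f} up triples L∈ F∈ F≤2)) ⟩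
      BDmeasure r - margin + e + (margin - (e + e))
        ≡⟨ solve 3 (λ b g e → b :- g :+ e :+ (g :- (e :+ e)) := b :- e) refl (BDmeasure r) margin e ⟩
      BDmeasure r - e
        ≤⟨ +-monoˡ-≤ (- e) (≤-trans (BDmeasure≤ {m} 0≤r r≤1)
             (measure-lipschitz {f = BDᵇ} (BDᵇ-upward {m}) 0≤r r≤1 0≤x x≤1 0≤δ r≤x+δ)) ⟩
      measure x (BDᵇ {m}) + e - e
        ≡⟨ solve 2 (λ b e → b :+ e :- e := b) refl (measure x (BDᵇ {m})) e ⟩
      measure x (BDᵇ {m}) ∎
      where
      0≤r : 0ℚ ≤ r
      0≤r = ≤-trans (nonNegative⁻¹ ⅖) ⅖≤r
      r≤1 : r ≤ 1ℚ
      r≤1 = ≤-trans r≤½ (toWitness {a? = ½ ≤? 1ℚ} tt)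

  -- `margin` exceeds 0.0018 by twice this. One ε absorbs the two Lipschitz errors of at most ε/2
  -- each, the other is the gap that strict order of reals asks for.
  ε : ℚ
  ε = + 1 / 100000

  ε/2 : ℚ
  ε/2 = + 1 / 200000

  tolerance : ∀ n → ∃ λ δ → 0ℚ < δ × ⟦ n ⟧ * δ ≤ ε/2 × δ ≤ ε/2
  tolerance n = δ , positive⁻¹ δ , bound , δ≤
    where
    open ≤-Reasoning
    k : ℚ
    k = ⟦ suc n ⟧
    1≤k : 1ℚ ≤ k
    1≤k = ⟦⟧-mono {1} {suc n} (s≤s z≤n)
    instance
      k-pos : Positive k
      k-pos = positive (<-≤-trans (positive⁻¹ 1ℚ) 1≤k)
      k-nonZero : NonZero k
      k-nonZero = pos⇒nonZero k
      1/k-pos : Positive (1/ k)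
      1/k-pos = 1/pos⇒pos k
    δ : ℚ
    δ = ε/2 * 1/ k
    instance
      δ-pos : Positive δ
      δ-pos = pos*pos⇒pos ε/2 (1/ k)
    kδ : k * δ ≡ ε/2
    kδ = trans (*-comm k δ) (trans (*-assoc ε/2 (1/ k) k) (trans (cong (ε/2 *_) (*-inverseˡ k)) (*-identityʳ ε/2)))
    bound : ⟦ n ⟧ * δ ≤ ε/2
    bound = subst (⟦ n ⟧ * δ ≤_) kδ (*-monoʳ-≤-nonNeg δ {{pos⇒nonNeg δ}} (⟦⟧-mono {n} {suc n} (ℕ.n≤1+n n)))
    δ≤ : δ ≤ ε/2
    δ≤ = subst₂ _≤_ (*-identityˡ δ) kδ (*-monoʳ-≤-nonNeg δ {{pos⇒nonNeg δ}} 1≤k)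

  empty-bound : ∀ {𝓕 : Family 0} → ThreeWiseIntersecting 𝓕 → ¬ (∃ λ F → 𝓕 F × ¬ BD₃ 0 F)
  empty-bound int ([] , F∈ , _) with int F∈ F∈ F∈
  ... | () , _

  module _ (p : ℝ) (⅖≤p : fromℚ ⅖ ℝ.≤ p) (p≤½ : p ℝ.≤ fromℚ ½) where

    Conclusion : ∀ n {𝓕 : Family n} → Decidable 𝓕 → Set
    Conclusion n 𝓕? = μ p 𝓕? ℝ.< μ p (BD₃? n) ℝ.- fromℚ (+ 18 / 10000)

    conclude : ∀ {m} {𝓕 : Family (4 ℕ.+ m)} (𝓕? : Decidable 𝓕) {f : Subset (4 ℕ.+ m) → Bool} → Upward f → Triples f →
      (λ G → isYes (𝓕? G)) ⊆ᶠ f → ∀ {L} → L ∈ f /ᶠ outside → ∀ {F} → F ∈ f → count F 4 ℕ.≤ 2 → Conclusion (4 ℕ.+ m) 𝓕?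
    conclude {m} 𝓕? {f} up triples 𝓕⊆f {L} L∈ {F} F∈ F≤2 = from (tolerance (4 ℕ.+ m))
      where
      n : ℕ
      n = 4 ℕ.+ m
      g : Subset n → Bool
      g G = isYes (𝓕? G)
      from : (∃ λ δ → 0ℚ < δ × ⟦ n ⟧ * δ ≤ ε/2 × δ ≤ ε/2) → Conclusion n 𝓕?
      from (δ , 0<δ , nδ≤ , δ≤) = eventually (⅖≤p δ 0<δ) (p≤½ δ 0<δ)
        where
        pointwise : ∀ x → ⅖ ≤ x + δ → x ≤ ½ + δ → measure x g + ε ≤ measure x (BDᵇ {m}) + - (+ 18 / 10000)
        pointwise x l u = begin
          measure x g + ε
            ≡⟨ solve 1 (λ a → a :+ con ε := a :+ (con margin :- (con ε/2 :+ con ε/2)) :- con (+ 18 / 10000)) refl (measure x g) ⟩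
          measure x g + (margin - (ε/2 + ε/2)) - (+ 18 / 10000)
            ≤⟨ +-monoˡ-≤ (- (+ 18 / 10000)) (≤-trans
                 (+-monoʳ-≤ (measure x g) (+-monoʳ-≤ margin (neg-antimono-≤ (+-mono-≤ nδ≤ nδ≤))))
                 (gap-near {f = f} {g} up triples 𝓕⊆f L∈ F∈ F≤2 0≤x x≤1 (<⇒≤ 0<δ) l u)) ⟩
          measure x (BDᵇ {m}) + - (+ 18 / 10000) ∎
          where
          open ≤-Reasoning
          0≤x : 0ℚ ≤ x
          0≤x = ≤-gap (0≤+ (0≤+ (0≤gap l) (0≤gap δ≤)) (nonNegative⁻¹ (⅖ - ε/2)))
            (solve 2 (λ x δ → x :- con 0ℚ := (x :+ δ :- con ⅖) :+ (con ε/2 :- δ) :+ con (⅖ - ε/2)) refl x δ)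
          x≤1 : x ≤ 1ℚ
          x≤1 = ≤-trans u (≤-trans (+-monoʳ-≤ ½ δ≤) (toWitness {a? = ½ + ε/2 ≤? 1ℚ} tt))
        eventually : (∃ λ N → ∀ k → N ℕ.≤ k → ⅖ ≤ seq p k + δ) → (∃ λ N → ∀ k → N ℕ.≤ k → seq p k ≤ ½ + δ) →
          Conclusion n 𝓕?
        eventually (M , l) (N , u) = ε , positive⁻¹ ε , M ℕ.⊔ N , λ k k≥ →
          subst₂ (λ a b → a + ε ≤ b + - (+ 18 / 10000)) (sym (seq-μ p 𝓕? k)) (sym (seq-μ p (BD₃? n) k))
            (pointwise (seq p k) (l k (ℕ.m⊔n≤o⇒m≤o M N k≥)) (u k (ℕ.m⊔n≤o⇒n≤o M N k≥)))

    stability : ∀ n (𝓕 : Family n) (𝓕? : Decidable 𝓕) → Shifted 𝓕 → NonTrivial 𝓕 → ThreeWiseIntersecting 𝓕 →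
      𝓕 ⊈ BD₃ n → Conclusion n 𝓕?
    stability zero 𝓕 𝓕? sh nt int 𝓕⊈BD = ⊥-elim (empty-bound {𝓕} int (outlier 𝓕 𝓕? 𝓕⊈BD))
    stability (suc n) 𝓕 𝓕? sh nt int 𝓕⊈BD = by-size n 𝓕 𝓕? sh int (avoiding-1 𝓕 𝓕? nt) (outlier 𝓕 𝓕? 𝓕⊈BD)
      where
      too-short : ∀ {n} (𝓕 : Family (suc n)) (𝓕? : Decidable 𝓕) → Shifted 𝓕 → ThreeWiseIntersecting 𝓕 →
        n ℕ.≤ 2 → ¬ (∃ λ L → 𝓕 (outside ∷ L))
      too-short 𝓕 𝓕? sh int n≤2 (L , L∈) =
        short {f = closure 𝓕 𝓕?} (closure-triples 𝓕 𝓕? sh int) n≤2 {L} (⊆-closure 𝓕 𝓕? {outside ∷ L} L∈)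

      by-size : ∀ n (𝓕 : Family (suc n)) (𝓕? : Decidable 𝓕) → Shifted 𝓕 → ThreeWiseIntersecting 𝓕 →
        (∃ λ L → 𝓕 (outside ∷ L)) → (∃ λ F → 𝓕 F × ¬ BD₃ (suc n) F) → Conclusion (suc n) 𝓕?
      by-size 0 𝓕 𝓕? sh int avoid _ = ⊥-elim (too-short 𝓕 𝓕? sh int z≤n avoid)
      by-size 1 𝓕 𝓕? sh int avoid _ = ⊥-elim (too-short 𝓕 𝓕? sh int (s≤s z≤n) avoid)
      by-size 2 𝓕 𝓕? sh int avoid _ = ⊥-elim (too-short 𝓕 𝓕? sh int ℕ.≤-refl avoid)
      by-size (suc (suc (suc m))) 𝓕 𝓕? sh int (L , L∈) (F , F∈ , F∉) =
        conclude 𝓕? {closure 𝓕 𝓕?} (closure-upward 𝓕 𝓕?) (closure-triples 𝓕 𝓕? sh int)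
          (λ {G} G∈ → ⊆-closure 𝓕 𝓕? {G} (toWitness {a? = 𝓕? G} G∈))
          {L} (⊆-closure 𝓕 𝓕? {outside ∷ L} L∈) {F} (⊆-closure 𝓕 𝓕? {F} F∈)
          (ℕ.≤-pred (ℕ.≰⇒> λ 3≤ → F∉ (subst (3 ℕ.≤_) (sym (∣∩initial∣ F)) 3≤)))

open import Defs
open import Data.Integer.Base using (+_)
open import Data.Nat.Base using (ℕ)
open import Data.Rational.Base using (_/_)
open import Relation.Unary using (Decidable; _⊈_)

theorem6 : ∀ (n : ℕ) (p : ℝ) → fromℚ (+ 2 / 5) ≤ p → p ≤ fromℚ (+ 1 / 2) →
    ∀ (𝓕 : Family n) (𝓕? : Decidable 𝓕) →
    Shifted 𝓕 → NonTrivial 𝓕 → ThreeWiseIntersecting 𝓕 →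
    𝓕 ⊈ BD₃ n →
    μ p 𝓕? < μ p (BD₃? n) - fromℚ (+ 18 / 10000)
theorem6 n p ⅖≤p p≤½ = Measures.stability p ⅖≤p p≤½ n
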